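{- Let $\xi$ be an irrational real number, and let $(p_k/q_k)_{k\ge0}$ be the sequence of convergents of $\xi$. Let $\mathbf{y}=\begin{pmatrix} y_1 \\ y_2 \end{pmatrix}\in\mathbb{R}^2$ (with $y_2\ne0$) be a point having rational slope $y_1/y_2=a/b$, where $a$ and $b$ are coprime integers with $|a|\le b$, and let $k$ be a positive integer such that $q_k\ge 12b/|y_2|$. Then, for any $\gamma\in\mathrm{SL}(2,\mathbb{Z})$ with norm $$|\gamma|\le\frac{|y_2|}{4}\,q_kq_{k+1},$$ we have the lower bound $$\left|\gamma\begin{pmatrix} \xi \\ 1 \end{pmatrix}-\mathbf{y}\right|\ge\frac{1}{4b\,q_k}.$$
   Context: For $\mathbf{z}=\begin{pmatrix} z_1 \\ z_2 \end{pmatrix}\in\mathbb{R}^2$, $|\mathbf{z}|=\max(|z_1|,|z_2|)$. For a matrix $\gamma$, $|\gamma|$ is the maximum of the absolute values of its entries. The convergents $p_k/q_k$ are the usual continued fraction convergents in lowest terms with $q_k>0$, indexed so that $p_0=\lfloor\xi\rfloor$, $q_0=1$. -}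

module Defs where

open import Data.Nat.Base as ℕ using (ℕ; zero; suc)
import Data.Nat.Properties as ℕ
import Data.Nat.Coprimality as ℕ
open import Data.Integer.Base as ℤ using (ℤ; +_; -[1+_])
import Data.Integer.Properties as ℤ
import Data.Integer.DivMod as ℤ
open import Data.Integer.Divisibility.Signed as ℤ∣ using () renaming (_∣_ to _∣ℤ_)
open import Data.Integer.Coprimality using (Coprime)
import Data.Integer.Solver as ℤSolver
open import Data.Rational.Base as ℚ using (ℚ; 0ℚ; 1ℚ; ½)
import Data.Rational.Properties as ℚ
open import Data.Rational.Solver using (module +-*-Solver)
open import Data.Product.Base using (∃; _×_; _,_; proj₁; proj₂)
open import Data.Sum.Base using (_⊎_; inj₁; inj₂)
open import Function.Base using (_∘_)
open import Relation.Nullary using (¬_; yes; no; contradiction)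
open import Relation.Binary.PropositionalEquality

open +-*-Solver using (solve; _:=_; _:+_; _:*_; :-_; _:-_; con)

shift< : ∀ {a b p q} → a ℚ.< b → b ℚ.- a ≡ q ℚ.- p → p ℚ.< q
shift< {a} {b} {p} {q} a<b eq = subst₂ ℚ._<_ (ℚ.+-identityˡ p) lem
  (ℚ.+-monoˡ-< p (subst₂ ℚ._<_ (ℚ.+-inverseʳ a) eq (ℚ.+-monoˡ-< (ℚ.- a) a<b)))
  where
  lem : q ℚ.- p ℚ.+ p ≡ q
  lem = solve 2 (λ q p → q :- p :+ p := q) refl q p

shift≤ : ∀ {a b p q} → a ℚ.≤ b → b ℚ.- a ≡ q ℚ.- p → p ℚ.≤ q
shift≤ {a} {b} {p} {q} a≤b eq = subst₂ ℚ._≤_ (ℚ.+-identityˡ p) lem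
  (ℚ.+-monoˡ-≤ p (subst₂ ℚ._≤_ (ℚ.+-inverseʳ a) eq (ℚ.+-monoˡ-≤ (ℚ.- a) a≤b)))
  where
  lem : q ℚ.- p ℚ.+ p ≡ q
  lem = solve 2 (λ q p → q :- p :+ p := q) refl q p

0<1 : 0ℚ ℚ.< 1ℚ
0<1 = ℚ.positive⁻¹ 1ℚ

0<½ : 0ℚ ℚ.< ½
0<½ = ℚ.positive⁻¹ ½

*-pos : ∀ {p q} → 0ℚ ℚ.< p → 0ℚ ℚ.< q → 0ℚ ℚ.< p ℚ.* q
*-pos {p} {q} 0<p 0<q = ℚ.positive⁻¹ (p ℚ.* q)
  {{ℚ.pos*pos⇒pos p {{ℚ.positive 0<p}} q {{ℚ.positive 0<q}}}}

*-mono-≤ : ∀ {a b c d} → 0ℚ ℚ.≤ a → 0ℚ ℚ.≤ d → a ℚ.≤ b → c ℚ.≤ d →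
           a ℚ.* c ℚ.≤ b ℚ.* d
*-mono-≤ {a} {b} {c} {d} 0≤a 0≤d a≤b c≤d = ℚ.≤-trans
  (ℚ.*-monoˡ-≤-nonNeg a {{ℚ.nonNegative 0≤a}} c≤d)
  (ℚ.*-monoʳ-≤-nonNeg d {{ℚ.nonNegative 0≤d}} a≤b)

*-mono-≤-< : ∀ {a b c d} → 0ℚ ℚ.< b → 0ℚ ℚ.≤ c → a ℚ.≤ b → c ℚ.< d →
             a ℚ.* c ℚ.< b ℚ.* d
*-mono-≤-< {a} {b} {c} {d} 0<b 0≤c a≤b c<d = ℚ.≤-<-trans
  (ℚ.*-monoʳ-≤-nonNeg c {{ℚ.nonNegative 0≤c}} a≤b)
  (ℚ.*-monoʳ-<-pos b {{ℚ.positive 0<b}} c<d)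

half : ℚ → ℚ
half ε = ½ ℚ.* ε

half-pos : ∀ {ε} → 0ℚ ℚ.< ε → 0ℚ ℚ.< half ε
half-pos = *-pos 0<½

half+half : ∀ ε → half ε ℚ.+ half ε ≡ ε
half+half = solve 1 (λ e → con ½ :* e :+ con ½ :* e := e) refl

p≤∣p∣ : ∀ p → p ℚ.≤ ℚ.∣ p ∣
p≤∣p∣ p with ℚ.≤-total 0ℚ p
... | inj₁ 0≤p = ℚ.≤-reflexive (sym (ℚ.0≤p⇒∣p∣≡p 0≤p))
... | inj₂ p≤0 = ℚ.≤-trans p≤0 (ℚ.0≤∣p∣ p)

-p≤∣p∣ : ∀ p → ℚ.- p ℚ.≤ ℚ.∣ p ∣
-p≤∣p∣ p = subst (ℚ.- p ℚ.≤_) (ℚ.∣-p∣≡∣p∣ p) (p≤∣p∣ (ℚ.- p))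

∣∣-lub-< : ∀ {p r} → p ℚ.< r → ℚ.- p ℚ.< r → ℚ.∣ p ∣ ℚ.< r
∣∣-lub-< {p} {r} p<r -p<r with ℚ.∣p∣≡p∨∣p∣≡-p p
... | inj₁ eq = subst (ℚ._< r) (sym eq) p<r
... | inj₂ eq = subst (ℚ._< r) (sym eq) -p<r

swap-sub : ∀ p q → ℚ.- (p ℚ.- q) ≡ q ℚ.- p
swap-sub = solve 2 (λ p q → :- (p :- q) := q :- p) refl

∣p-q∣≡∣q-p∣ : ∀ p q → ℚ.∣ p ℚ.- q ∣ ≡ ℚ.∣ q ℚ.- p ∣
∣p-q∣≡∣q-p∣ p q = trans (sym (ℚ.∣-p∣≡∣p∣ (p ℚ.- q))) (cong ℚ.∣_∣ (swap-sub p q))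

near⇒< : ∀ p q {ε} → ℚ.∣ p ℚ.- q ∣ ℚ.< ε → p ℚ.< q ℚ.+ ε
near⇒< p q {ε} near = shift< (ℚ.≤-<-trans (p≤∣p∣ (p ℚ.- q)) near)
  (solve 3 (λ p q e → e :- (p :- q) := q :+ e :- p) refl p q ε)

near⇒> : ∀ p q {ε} → ℚ.∣ p ℚ.- q ∣ ℚ.< ε → q ℚ.< p ℚ.+ ε
near⇒> p q near = near⇒< q p (subst (ℚ._< _) (∣p-q∣≡∣q-p∣ p q) near)

<⇒near : ∀ p q {ε} → p ℚ.< q ℚ.+ ε → q ℚ.< p ℚ.+ ε → ℚ.∣ p ℚ.- q ∣ ℚ.< ε
<⇒near p q {ε} p<q+ε q<p+ε = ∣∣-lub-<
  (shift< p<q+ε (solve 3 (λ p q e → q :+ e :- p := e :- (p :- q)) refl p q ε))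
  (shift< q<p+ε (solve 3 (λ p q e → p :+ e :- q := e :- (:- (p :- q))) refl p q ε))

neg-near : ∀ p q {ε} → ℚ.∣ p ℚ.- q ∣ ℚ.< ε → ℚ.∣ ℚ.- p ℚ.- ℚ.- q ∣ ℚ.< ε
neg-near p q = subst (ℚ._< _) (trans (∣p-q∣≡∣q-p∣ p q)
  (cong ℚ.∣_∣ (solve 2 (λ a b → b :- a := :- a :- (:- b)) refl p q)))

+-near : ∀ a a′ b b′ {δ ε} → ℚ.∣ a ℚ.- a′ ∣ ℚ.< δ → ℚ.∣ b ℚ.- b′ ∣ ℚ.< ε →
         ℚ.∣ a ℚ.+ b ℚ.- (a′ ℚ.+ b′) ∣ ℚ.< δ ℚ.+ ε
+-near a a′ b b′ {δ} {ε} p q = begin-strict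
  ℚ.∣ a ℚ.+ b ℚ.- (a′ ℚ.+ b′) ∣
    ≡⟨ cong ℚ.∣_∣ (solve 4 (λ a b c d → a :+ b :- (c :+ d) := a :- c :+ (b :- d)) refl a b a′ b′) ⟩
  ℚ.∣ a ℚ.- a′ ℚ.+ (b ℚ.- b′) ∣
    ≤⟨ ℚ.∣p+q∣≤∣p∣+∣q∣ (a ℚ.- a′) (b ℚ.- b′) ⟩
  ℚ.∣ a ℚ.- a′ ∣ ℚ.+ ℚ.∣ b ℚ.- b′ ∣
    <⟨ ℚ.+-mono-< p q ⟩
  δ ℚ.+ ε ∎
  where open ℚ.≤-Reasoning

*-near : ∀ a a′ b b′ {A B δ ε} → 0ℚ ℚ.< A → 0ℚ ℚ.< B →
         ℚ.∣ a ∣ ℚ.≤ A → ℚ.∣ b′ ∣ ℚ.≤ B → ℚ.∣ b ℚ.- b′ ∣ ℚ.< δ → ℚ.∣ a ℚ.- a′ ∣ ℚ.< ε →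
         ℚ.∣ a ℚ.* b ℚ.- a′ ℚ.* b′ ∣ ℚ.< A ℚ.* δ ℚ.+ B ℚ.* ε
*-near a a′ b b′ {A} {B} {δ} {ε} 0<A 0<B a≤A b′≤B p q = begin-strict
  ℚ.∣ a ℚ.* b ℚ.- a′ ℚ.* b′ ∣
    ≡⟨ cong ℚ.∣_∣ (solve 4 (λ a b c d → a :* b :- c :* d := a :* (b :- d) :+ d :* (a :- c))
         refl a b a′ b′) ⟩
  ℚ.∣ a ℚ.* (b ℚ.- b′) ℚ.+ b′ ℚ.* (a ℚ.- a′) ∣
    ≤⟨ ℚ.∣p+q∣≤∣p∣+∣q∣ (a ℚ.* (b ℚ.- b′)) (b′ ℚ.* (a ℚ.- a′)) ⟩
  ℚ.∣ a ℚ.* (b ℚ.- b′) ∣ ℚ.+ ℚ.∣ b′ ℚ.* (a ℚ.- a′) ∣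
    ≡⟨ cong₂ ℚ._+_ (ℚ.∣p*q∣≡∣p∣*∣q∣ a (b ℚ.- b′)) (ℚ.∣p*q∣≡∣p∣*∣q∣ b′ (a ℚ.- a′)) ⟩
  ℚ.∣ a ∣ ℚ.* ℚ.∣ b ℚ.- b′ ∣ ℚ.+ ℚ.∣ b′ ∣ ℚ.* ℚ.∣ a ℚ.- a′ ∣
    <⟨ ℚ.+-mono-< (*-mono-≤-< 0<A (ℚ.0≤∣p∣ (b ℚ.- b′)) a≤A p)
                  (*-mono-≤-< 0<B (ℚ.0≤∣p∣ (a ℚ.- a′)) b′≤B q) ⟩
  A ℚ.* δ ℚ.+ B ℚ.* ε ∎
  where open ℚ.≤-Reasoning

⊔-lub-< : ∀ p q {r} → p ℚ.< r → q ℚ.< r → p ℚ.⊔ q ℚ.< r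
⊔-lub-< p q {r} p<r q<r with ℚ.≤-total p q
... | inj₁ p≤q = subst (ℚ._< r) (sym (ℚ.p≤q⇒p⊔q≡q p≤q)) q<r
... | inj₂ q≤p = subst (ℚ._< r) (sym (ℚ.p≥q⇒p⊔q≡p q≤p)) p<r

⊔-near : ∀ a a′ b b′ {ε} → ℚ.∣ a ℚ.- a′ ∣ ℚ.< ε → ℚ.∣ b ℚ.- b′ ∣ ℚ.< ε →
         ℚ.∣ a ℚ.⊔ b ℚ.- (a′ ℚ.⊔ b′) ∣ ℚ.< ε
⊔-near a a′ b b′ {ε} p q = <⇒near (a ℚ.⊔ b) (a′ ℚ.⊔ b′)
  (⊔-lub-< a b (ℚ.<-≤-trans (near⇒< a a′ p) (ℚ.+-monoˡ-≤ ε (ℚ.p≤p⊔q a′ b′)))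
               (ℚ.<-≤-trans (near⇒< b b′ q) (ℚ.+-monoˡ-≤ ε (ℚ.p≤q⊔p a′ b′))))
  (⊔-lub-< a′ b′ (ℚ.<-≤-trans (near⇒> a a′ p) (ℚ.+-monoˡ-≤ ε (ℚ.p≤p⊔q a b)))
                 (ℚ.<-≤-trans (near⇒> b b′ q) (ℚ.+-monoˡ-≤ ε (ℚ.p≤q⊔p a b))))

∣p∣≤∣q∣+∣p-q∣ : ∀ p q → ℚ.∣ p ∣ ℚ.≤ ℚ.∣ q ∣ ℚ.+ ℚ.∣ p ℚ.- q ∣
∣p∣≤∣q∣+∣p-q∣ p q = subst (λ r → ℚ.∣ r ∣ ℚ.≤ ℚ.∣ q ∣ ℚ.+ ℚ.∣ p ℚ.- q ∣)
  (solve 2 (λ p q → q :+ (p :- q) := p) refl p q) (ℚ.∣p+q∣≤∣p∣+∣q∣ q (p ℚ.- q))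

∣∣-near : ∀ p q {ε} → ℚ.∣ p ℚ.- q ∣ ℚ.< ε → ℚ.∣ ℚ.∣ p ∣ ℚ.- ℚ.∣ q ∣ ∣ ℚ.< ε
∣∣-near p q {ε} near = <⇒near ℚ.∣ p ∣ ℚ.∣ q ∣
  (ℚ.≤-<-trans (∣p∣≤∣q∣+∣p-q∣ p q) (ℚ.+-monoʳ-< ℚ.∣ q ∣ near))
  (ℚ.≤-<-trans (∣p∣≤∣q∣+∣p-q∣ q p)
    (ℚ.+-monoʳ-< ℚ.∣ p ∣ (subst (ℚ._< ε) (∣p-q∣≡∣q-p∣ p q) near)))

pos⇒≢0 : ∀ {p} → 0ℚ ℚ.< p → p ≢ 0ℚ
pos⇒≢0 0<p p≡0 = ℚ.<⇒≢ 0<p (sym p≡0)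

-- The reciprocal, extended by 0 so that it can be applied termwise to a
-- sequence of rationals that is only eventually nonzero.

inv : ℚ → ℚ
inv p with p ℚ.≟ 0ℚ
... | yes _  = 0ℚ
... | no p≢0 = (ℚ.1/ p) {{ℚ.≢-nonZero p≢0}}

inv-inverseʳ : ∀ {p} → p ≢ 0ℚ → p ℚ.* inv p ≡ 1ℚ
inv-inverseʳ {p} p≢0 with p ℚ.≟ 0ℚ
... | yes p≡0 = contradiction p≡0 p≢0
... | no p≢0′ = ℚ.*-inverseʳ p {{ℚ.≢-nonZero p≢0′}}

inv-inverseˡ : ∀ {p} → p ≢ 0ℚ → inv p ℚ.* p ≡ 1ℚ
inv-inverseˡ {p} p≢0 = trans (ℚ.*-comm (inv p) p) (inv-inverseʳ p≢0)

inv-pos : ∀ {p} → 0ℚ ℚ.< p → 0ℚ ℚ.< inv p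
inv-pos {p} 0<p = ℚ.*-cancelˡ-<-nonNeg p {{ℚ.nonNegative (ℚ.<⇒≤ 0<p)}}
  (subst₂ ℚ._<_ (sym (ℚ.*-zeroʳ p)) (sym (inv-inverseʳ (pos⇒≢0 0<p))) 0<1)

share : ∀ {B ε} → 0ℚ ℚ.< B → 0ℚ ℚ.< ε → ∃ λ δ → 0ℚ ℚ.< δ × B ℚ.* δ ≡ ε
share {B} {ε} 0<B 0<ε = ε ℚ.* inv B , *-pos 0<ε (inv-pos 0<B) , (begin
  B ℚ.* (ε ℚ.* inv B)  ≡⟨ solve 3 (λ B e i → B :* (e :* i) := e :* (B :* i)) refl B ε (inv B) ⟩
  ε ℚ.* (B ℚ.* inv B)  ≡⟨ cong (ε ℚ.*_) (inv-inverseʳ (pos⇒≢0 0<B)) ⟩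
  ε ℚ.* 1ℚ             ≡⟨ ℚ.*-identityʳ ε ⟩
  ε                    ∎)
  where open ≡-Reasoning

∣p∣≢0⇒p≢0 : ∀ {p c} → 0ℚ ℚ.< c → c ℚ.≤ ℚ.∣ p ∣ → p ≢ 0ℚ
∣p∣≢0⇒p≢0 0<c c≤∣p∣ refl = ℚ.<⇒≢ (ℚ.<-≤-trans 0<c c≤∣p∣) refl

inv-near : ∀ a b {c ε} → 0ℚ ℚ.< c → 0ℚ ℚ.< ε → c ℚ.≤ ℚ.∣ a ∣ → c ℚ.≤ ℚ.∣ b ∣ →
           ℚ.∣ b ℚ.- a ∣ ℚ.< ε ℚ.* (c ℚ.* c) → ℚ.∣ inv a ℚ.- inv b ∣ ℚ.< ε
inv-near a b {c} {ε} 0<c 0<ε c≤a c≤b near = ℚ.≰⇒> λ ε≤ →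
  ℚ.<⇒≢ (begin-strict
  ℚ.∣ b ℚ.- a ∣
    <⟨ near ⟩
  ε ℚ.* (c ℚ.* c)
    ≤⟨ *-mono-≤ (ℚ.<⇒≤ 0<ε) (subst (0ℚ ℚ.≤_) (ℚ.∣p*q∣≡∣p∣*∣q∣ a b) (ℚ.0≤∣p∣ (a ℚ.* b))) ε≤
         (*-mono-≤ (ℚ.<⇒≤ 0<c) (ℚ.0≤∣p∣ b) c≤a c≤b) ⟩
  ℚ.∣ inv a ℚ.- inv b ∣ ℚ.* (ℚ.∣ a ∣ ℚ.* ℚ.∣ b ∣)
    ≡⟨ cong (ℚ.∣ inv a ℚ.- inv b ∣ ℚ.*_) (ℚ.∣p*q∣≡∣p∣*∣q∣ a b) ⟨
  ℚ.∣ inv a ℚ.- inv b ∣ ℚ.* ℚ.∣ a ℚ.* b ∣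
    ≡⟨ ℚ.∣p*q∣≡∣p∣*∣q∣ (inv a ℚ.- inv b) (a ℚ.* b) ⟨
  ℚ.∣ (inv a ℚ.- inv b) ℚ.* (a ℚ.* b) ∣
    ≡⟨ cong ℚ.∣_∣ (solve 4 (λ a b i j → (i :- j) :* (a :* b) := (i :* a) :* b :- (j :* b) :* a)
         refl a b (inv a) (inv b)) ⟩
  ℚ.∣ inv a ℚ.* a ℚ.* b ℚ.- inv b ℚ.* b ℚ.* a ∣
    ≡⟨ cong₂ (λ i j → ℚ.∣ i ℚ.* b ℚ.- j ℚ.* a ∣)
         (inv-inverseˡ (∣p∣≢0⇒p≢0 0<c c≤a)) (inv-inverseˡ (∣p∣≢0⇒p≢0 0<c c≤b)) ⟩
  ℚ.∣ 1ℚ ℚ.* b ℚ.- 1ℚ ℚ.* a ∣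
    ≡⟨ cong₂ (λ i j → ℚ.∣ i ℚ.- j ∣) (ℚ.*-identityˡ b) (ℚ.*-identityˡ a) ⟩
  ℚ.∣ b ℚ.- a ∣ ∎) refl
  where open ℚ.≤-Reasoning

Eventually : (ℕ → Set) → Set
Eventually P = ∃ λ N → ∀ n → N ℕ.≤ n → P n

IsCauchy : (ℕ → ℚ) → Set
IsCauchy f = ∀ ε → 0ℚ ℚ.< ε →
  ∃ λ N → ∀ m n → N ℕ.≤ m → N ℕ.≤ n → ℚ.∣ f m ℚ.- f n ∣ ℚ.< ε

Bounded : (ℕ → ℚ) → Set
Bounded f = ∃ λ B → 0ℚ ℚ.< B × Eventually λ n → ℚ.∣ f n ∣ ℚ.≤ B

AwayFrom0 : (ℕ → ℚ) → Set
AwayFrom0 f = ∃ λ c → 0ℚ ℚ.< c × Eventually λ n → c ℚ.≤ ℚ.∣ f n ∣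

mapEv : ∀ {P Q : ℕ → Set} → (∀ n → P n → Q n) → Eventually P → Eventually Q
mapEv f (N , p) = N , λ n N≤n → f n (p n N≤n)

Close : (ℕ → ℚ) → ℚ → Set
Close f ε = ∃ λ N → ∀ m n → N ℕ.≤ m → N ℕ.≤ n → ℚ.∣ f m ℚ.- f n ∣ ℚ.< ε

zipClose : ∀ {f g h δ η ε} →
  (∀ m n → ℚ.∣ f m ℚ.- f n ∣ ℚ.< δ → ℚ.∣ g m ℚ.- g n ∣ ℚ.< η → ℚ.∣ h m ℚ.- h n ∣ ℚ.< ε) →
  Close f δ → Close g η → Close h ε
zipClose k (M , p) (N , q) = M ℕ.⊔ N , λ m n K≤m K≤n → k m n
  (p m n (ℕ.m⊔n≤o⇒m≤o M N K≤m) (ℕ.m⊔n≤o⇒m≤o M N K≤n))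
  (q m n (ℕ.m⊔n≤o⇒n≤o M N K≤m) (ℕ.m⊔n≤o⇒n≤o M N K≤n))

∣∣-away : ∀ f → AwayFrom0 f → AwayFrom0 (λ n → ℚ.∣ f n ∣)
∣∣-away f (c , 0<c , N , far) = c , 0<c , N , λ n N≤n →
  subst (c ℚ.≤_) (sym (ℚ.∣∣p∣∣≡∣p∣ (f n))) (far n N≤n)

*-away : ∀ f g → AwayFrom0 f → AwayFrom0 g → AwayFrom0 (λ n → f n ℚ.* g n)
*-away f g (c , 0<c , M , farᶠ) (d , 0<d , N , farᵍ) =
  c ℚ.* d , *-pos 0<c 0<d , M ℕ.⊔ N , λ n K≤n →
  subst (c ℚ.* d ℚ.≤_) (sym (ℚ.∣p*q∣≡∣p∣*∣q∣ (f n) (g n)))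
    (*-mono-≤ (ℚ.<⇒≤ 0<c) (ℚ.0≤∣p∣ (g n))
      (farᶠ n (ℕ.m⊔n≤o⇒m≤o M N K≤n)) (farᵍ n (ℕ.m⊔n≤o⇒n≤o M N K≤n)))

const-cauchy : ∀ p → IsCauchy (λ _ → p)
const-cauchy p ε 0<ε = 0 , λ _ _ _ _ →
  subst (λ r → ℚ.∣ r ∣ ℚ.< ε) (sym (ℚ.+-inverseʳ p)) 0<ε

+-cauchy : ∀ f g → IsCauchy f → IsCauchy g → IsCauchy (λ n → f n ℚ.+ g n)
+-cauchy f g cf cg ε 0<ε = zipClose {f} {g} {λ n → f n ℚ.+ g n}
  (λ m n p q → subst (ℚ.∣ f m ℚ.+ g m ℚ.- (f n ℚ.+ g n) ∣ ℚ.<_) (half+half ε)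
    (+-near (f m) (f n) (g m) (g n) p q))
  (cf (half ε) (half-pos 0<ε)) (cg (half ε) (half-pos 0<ε))

neg-cauchy : ∀ f → IsCauchy f → IsCauchy (λ n → ℚ.- f n)
neg-cauchy f cf ε 0<ε = proj₁ (cf ε 0<ε) , λ m n N≤m N≤n →
  neg-near (f m) (f n) (proj₂ (cf ε 0<ε) m n N≤m N≤n)

∣∣-cauchy : ∀ f → IsCauchy f → IsCauchy (λ n → ℚ.∣ f n ∣)
∣∣-cauchy f cf ε 0<ε = proj₁ (cf ε 0<ε) , λ m n N≤m N≤n →
  ∣∣-near (f m) (f n) (proj₂ (cf ε 0<ε) m n N≤m N≤n)

⊔-cauchy : ∀ f g → IsCauchy f → IsCauchy g → IsCauchy (λ n → f n ℚ.⊔ g n)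
⊔-cauchy f g cf cg ε 0<ε = zipClose {f} {g} {λ n → f n ℚ.⊔ g n}
  (λ m n → ⊔-near (f m) (f n) (g m) (g n)) (cf ε 0<ε) (cg ε 0<ε)

cauchy⇒bounded : ∀ f → IsCauchy f → Bounded f
cauchy⇒bounded f cf =
  ℚ.∣ f N ∣ ℚ.+ 1ℚ , ℚ.+-mono-≤-< (ℚ.0≤∣p∣ (f N)) 0<1 , N , λ n N≤n →
  ℚ.<⇒≤ (ℚ.≤-<-trans (∣p∣≤∣q∣+∣p-q∣ (f n) (f N))
    (ℚ.+-monoʳ-< ℚ.∣ f N ∣ (proj₂ (cf 1ℚ 0<1) n N N≤n ℕ.≤-refl)))
  where N = proj₁ (cf 1ℚ 0<1)

*-cauchy : ∀ f g → IsCauchy f → IsCauchy g → IsCauchy (λ n → f n ℚ.* g n)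
*-cauchy f g cf cg = go (cauchy⇒bounded f cf) (cauchy⇒bounded g cg)
  where
  go : Bounded f → Bounded g → IsCauchy (λ n → f n ℚ.* g n)
  go (A , 0<A , M , ≤A) (B , 0<B , N , ≤B) ε 0<ε =
    let δ , 0<δ , Aδ≡ε/2 = share 0<A (half-pos 0<ε)
        η , 0<η , Bη≡ε/2 = share 0<B (half-pos 0<ε)
        P , p = cg δ 0<δ
        Q , q = cf η 0<η
        MN = M ℕ.⊔ N ; PQ = P ℕ.⊔ Q
    in MN ℕ.⊔ PQ , λ m n K≤m K≤n →
      let MN≤m = ℕ.m⊔n≤o⇒m≤o MN PQ K≤m ; PQ≤m = ℕ.m⊔n≤o⇒n≤o MN PQ K≤m
          MN≤n = ℕ.m⊔n≤o⇒m≤o MN PQ K≤n ; PQ≤n = ℕ.m⊔n≤o⇒n≤o MN PQ K≤n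
      in subst (ℚ.∣ f m ℚ.* g m ℚ.- f n ℚ.* g n ∣ ℚ.<_)
        (trans (cong₂ ℚ._+_ Aδ≡ε/2 Bη≡ε/2) (half+half ε))
        (*-near (f m) (f n) (g m) (g n) 0<A 0<B
          (≤A m (ℕ.m⊔n≤o⇒m≤o M N MN≤m)) (≤B n (ℕ.m⊔n≤o⇒n≤o M N MN≤n))
          (p m n (ℕ.m⊔n≤o⇒m≤o P Q PQ≤m) (ℕ.m⊔n≤o⇒m≤o P Q PQ≤n))
          (q m n (ℕ.m⊔n≤o⇒n≤o P Q PQ≤m) (ℕ.m⊔n≤o⇒n≤o P Q PQ≤n)))

inv-cauchy : ∀ f → AwayFrom0 f → IsCauchy f → IsCauchy (λ n → inv (f n))
inv-cauchy f (c , 0<c , M , far) cf ε 0<ε =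
  let N , close = cf (ε ℚ.* (c ℚ.* c)) (*-pos 0<ε (*-pos 0<c 0<c))
  in M ℕ.⊔ N , λ m n K≤m K≤n → inv-near (f m) (f n) 0<c 0<ε
    (far m (ℕ.m⊔n≤o⇒m≤o M N K≤m)) (far n (ℕ.m⊔n≤o⇒m≤o M N K≤n))
    (close n m (ℕ.m⊔n≤o⇒n≤o M N K≤n) (ℕ.m⊔n≤o⇒n≤o M N K≤m))

-- Real numbers as Cauchy sequences of rationals; their equality is _≃_.
record ℝ : Set where
  no-eta-equality
  field
    seq    : ℕ → ℚ
    cauchy : IsCauchy seq

open ℝ public

infix  4 _≃_ _<_ _≤_ _#_
infixl 6 _+_ _-_ _⊔_
infixl 7 _*_ _÷_
infix  8 -_ _⁻¹

_≃_ : ℝ → ℝ → Set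
x ≃ y = ∀ ε → 0ℚ ℚ.< ε → Eventually λ n → ℚ.∣ seq x n ℚ.- seq y n ∣ ℚ.< ε

_<_ : ℝ → ℝ → Set
x < y = ∃ λ ε → 0ℚ ℚ.< ε × Eventually λ n → seq x n ℚ.+ ε ℚ.≤ seq y n

_≤_ : ℝ → ℝ → Set
x ≤ y = ¬ (y < x)

-- Apartness, the constructive form of x ≠ y.
_#_ : ℝ → ℝ → Set
x # y = x < y ⊎ y < x

fromℚ : ℚ → ℝ
seq    (fromℚ p) _ = p
cauchy (fromℚ p)   = const-cauchy p

fromℤ : ℤ → ℝ
seq    (fromℤ i) _ = i ℚ./ 1
cauchy (fromℤ i)   = const-cauchy (i ℚ./ 1)

0ℝ 1ℝ : ℝ
0ℝ = fromℤ (+ 0)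
1ℝ = fromℤ (+ 1)

_+_ : ℝ → ℝ → ℝ
seq    (x + y) n = seq x n ℚ.+ seq y n
cauchy (x + y)   = +-cauchy (seq x) (seq y) (cauchy x) (cauchy y)

-_ : ℝ → ℝ
seq    (- x) n = ℚ.- seq x n
cauchy (- x)   = neg-cauchy (seq x) (cauchy x)

_-_ : ℝ → ℝ → ℝ
x - y = x + (- y)

_*_ : ℝ → ℝ → ℝ
seq    (x * y) n = seq x n ℚ.* seq y n
cauchy (x * y)   = *-cauchy (seq x) (seq y) (cauchy x) (cauchy y)

_⊔_ : ℝ → ℝ → ℝ
seq    (x ⊔ y) n = seq x n ℚ.⊔ seq y n
cauchy (x ⊔ y)   = ⊔-cauchy (seq x) (seq y) (cauchy x) (cauchy y)

∣_∣ : ℝ → ℝ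
seq    ∣ x ∣ n = ℚ.∣ seq x n ∣
cauchy ∣ x ∣   = ∣∣-cauchy (seq x) (cauchy x)

record NonZero (x : ℝ) : Set where
  constructor mkNonZero
  field
    apart : x # 0ℝ

Separated : ℝ → ℝ → Set
Separated x y = ∃ λ ε → 0ℚ ℚ.< ε × Eventually λ n → ε ℚ.≤ ℚ.∣ seq x n ℚ.- seq y n ∣

#⇒separated : ∀ x y → x # y → Separated x y
#⇒separated x y (inj₁ (ε , 0<ε , x<y)) = ε , 0<ε , mapEv (λ n le →
  ℚ.≤-trans
    (shift≤ le (solve 3 (λ a b e → b :- (a :+ e) := :- (a :- b) :- e) refl (seq x n) (seq y n) ε))
    (-p≤∣p∣ (seq x n ℚ.- seq y n))) x<y
#⇒separated x y (inj₂ (ε , 0<ε , y<x)) = ε , 0<ε , mapEv (λ n le →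
  ℚ.≤-trans
    (shift≤ le (solve 3 (λ a b e → a :- (b :+ e) := a :- b :- e) refl (seq x n) (seq y n) ε))
    (p≤∣p∣ (seq x n ℚ.- seq y n))) y<x

separated⇒# : ∀ x y → Separated x y → x # y
separated⇒# x y (ε , 0<ε , N , far) = go (ℚ.∣p∣≡p∨∣p∣≡-p (d K))
  where
  d = seq (x - y)
  M = proj₁ (cauchy (x - y) (half ε) (half-pos 0<ε))
  close = proj₂ (cauchy (x - y) (half ε) (half-pos 0<ε))
  K = M ℕ.⊔ N
  far-K : ε ℚ.≤ ℚ.∣ d K ∣
  far-K = far K (ℕ.m≤n⊔m M N)
  close-K : ∀ n → K ℕ.≤ n → ℚ.∣ d n ℚ.- d K ∣ ℚ.< half ε
  close-K n K≤n = close n K (ℕ.≤-trans (ℕ.m≤m⊔n M N) K≤n) (ℕ.m≤m⊔n M N)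
  go : ℚ.∣ d K ∣ ≡ d K ⊎ ℚ.∣ d K ∣ ≡ ℚ.- d K → x # y
  go (inj₁ eq) = inj₂ (half ε , half-pos 0<ε , K , λ n K≤n → ℚ.<⇒≤ (shift<
    (ℚ.+-mono-≤-< (subst (ε ℚ.≤_) eq far-K) (near⇒> (d n) (d K) (close-K n K≤n)))
    (solve 4 (λ a b e k → k :+ (a :+ (:- b) :+ con ½ :* e) :- (e :+ k) := a :- (b :+ con ½ :* e))
      refl (seq x n) (seq y n) ε (d K))))
  go (inj₂ eq) = inj₁ (half ε , half-pos 0<ε , K , λ n K≤n → ℚ.<⇒≤ (shift<
    (ℚ.+-mono-≤-< (subst (ε ℚ.≤_) eq far-K) (near⇒< (d n) (d K) (close-K n K≤n)))
    (solve 4 (λ a b e k → :- k :+ (k :+ con ½ :* e) :- (e :+ (a :+ (:- b))) := b :- (a :+ con ½ :* e))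
      refl (seq x n) (seq y n) ε (d K))))

p-0≡p : ∀ p → p ℚ.- 0ℚ ≡ p
p-0≡p = solve 1 (λ p → p :- con 0ℚ := p) refl

away : ∀ x {{_ : NonZero x}} → AwayFrom0 (seq x)
away x {{mkNonZero x#0}} with #⇒separated x 0ℝ x#0
... | c , 0<c , far = c , 0<c , mapEv (λ n → subst (λ r → c ℚ.≤ ℚ.∣ r ∣) (p-0≡p (seq x n))) far

away⇒nonZero : ∀ x → AwayFrom0 (seq x) → NonZero x
away⇒nonZero x (c , 0<c , far) = mkNonZero (separated⇒# x 0ℝ
  (c , 0<c , mapEv (λ n → subst (λ r → c ℚ.≤ ℚ.∣ r ∣) (sym (p-0≡p (seq x n)))) far))

_⁻¹ : (x : ℝ) → {{NonZero x}} → ℝ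
seq    (x ⁻¹) n = inv (seq x n)
cauchy (x ⁻¹)   = inv-cauchy (seq x) (away x) (cauchy x)

_÷_ : (x y : ℝ) → {{NonZero y}} → ℝ
x ÷ y = x * y ⁻¹

/1≡mkℚ : ∀ i → i ℚ./ 1 ≡ ℚ.mkℚ i 0 (ℕ.sym (ℕ.1-coprimeTo _))
/1≡mkℚ (+ n)    = ℚ.normalize-coprime (ℕ.sym (ℕ.1-coprimeTo n))
/1≡mkℚ -[1+ n ] = cong ℚ.-_ (ℚ.normalize-coprime (ℕ.sym (ℕ.1-coprimeTo (suc n))))

/1-+ : ∀ i j → (i ℤ.+ j) ℚ./ 1 ≡ i ℚ./ 1 ℚ.+ j ℚ./ 1
/1-+ i j = trans
  (cong (ℚ._/ 1) (sym (cong₂ ℤ._+_ (ℤ.*-identityʳ i) (ℤ.*-identityʳ j))))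
  (sym (cong₂ ℚ._+_ (/1≡mkℚ i) (/1≡mkℚ j)))

/1-mono-≤ : ∀ {i j} → i ℤ.≤ j → i ℚ./ 1 ℚ.≤ j ℚ./ 1
/1-mono-≤ {i} {j} i≤j = subst₂ ℚ._≤_ (sym (/1≡mkℚ i)) (sym (/1≡mkℚ j))
  (ℚ.*≤* (ℤ.*-monoʳ-≤-nonNeg (+ 1) i≤j))

/1-≢0 : ∀ i .{{_ : ℤ.NonZero i}} → i ℚ./ 1 ≢ 0ℚ
/1-≢0 i eq = ℕ.≢-nonZero⁻¹ ℤ.∣ i ∣ (cong (ℤ.∣_∣ ∘ ℚ.↥_) (trans (sym (/1≡mkℚ i)) eq))

instance
  ∣∣-nonZero : ∀ {x} {{_ : NonZero x}} → NonZero ∣ x ∣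
  ∣∣-nonZero {x} = away⇒nonZero ∣ x ∣ (∣∣-away (seq x) (away x))

  *-nonZero : ∀ {x y} {{_ : NonZero x}} {{_ : NonZero y}} → NonZero (x * y)
  *-nonZero {x} {y} = away⇒nonZero (x * y) (*-away (seq x) (seq y) (away x) (away y))

  fromℤ-nonZero : ∀ {i} {{_ : ℤ.NonZero i}} → NonZero (fromℤ i)
  fromℤ-nonZero {i} = away⇒nonZero (fromℤ i) (ℚ.∣ i ℚ./ 1 ∣ , 0<∣i∣ , 0 , λ _ _ → ℚ.≤-refl)
    where
    0<∣i∣ : 0ℚ ℚ.< ℚ.∣ i ℚ./ 1 ∣
    0<∣i∣ = ℚ.≰⇒> λ ∣i∣≤0 → /1-≢0 i
      (ℚ.∣p∣≡0⇒p≡0 (i ℚ./ 1) (ℚ.≤-antisym ∣i∣≤0 (ℚ.0≤∣p∣ (i ℚ./ 1))))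

-- Positive form of irrationality: apartness from every rational, which is
-- what makes the integer part computable.
Irrational : ℝ → Set
Irrational x = ∀ r → x # fromℚ r

IsFloor : ℤ → ℝ → Set
IsFloor m x = fromℤ m ≤ x × x < fromℤ (m ℤ.+ + 1)

fromℚ-≤ : ∀ p x → Eventually (λ n → p ℚ.≤ seq x n) → fromℚ p ≤ x
fromℚ-≤ p x (N , p≤) (ε , 0<ε , M , x<p) = ℚ.<⇒≢ (ℚ.<-≤-trans lt le) refl
  where
  K = M ℕ.⊔ N
  lt : seq x K ℚ.< seq x K ℚ.+ ε
  lt = subst (ℚ._< seq x K ℚ.+ ε) (ℚ.+-identityʳ (seq x K)) (ℚ.+-monoʳ-< (seq x K) 0<ε)
  le : seq x K ℚ.+ ε ℚ.≤ seq x K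
  le = ℚ.≤-trans (x<p K (ℕ.m≤m⊔n M N)) (p≤ K (ℕ.m≤n⊔m M N))

p+ε≤q⇒p≤q : ∀ p q {ε} → 0ℚ ℚ.< ε → p ℚ.+ ε ℚ.≤ q → p ℚ.≤ q
p+ε≤q⇒p≤q p q {ε} 0<ε = ℚ.≤-trans
  (subst (ℚ._≤ p ℚ.+ ε) (ℚ.+-identityʳ p) (ℚ.+-monoʳ-≤ p (ℚ.<⇒≤ 0<ε)))

fromℚ-<⇒≤ : ∀ p x → fromℚ p < x → fromℚ p ≤ x
fromℚ-<⇒≤ p x (ε , 0<ε , N , p<x) = fromℚ-≤ p x (N , λ n N≤n →
  p+ε≤q⇒p≤q p (seq x n) 0<ε (p<x n N≤n))

floor-≤ : ∀ p → ℚ.floor p ℚ./ 1 ℚ.≤ p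
floor-≤ p@(ℚ.mkℚ n d-1 _) = subst (ℚ._≤ p) (sym (/1≡mkℚ (ℚ.floor p)))
  (ℚ.*≤* (subst (ℚ.floor p ℤ.* + suc d-1 ℤ.≤_) (sym (ℤ.*-identityʳ n)) (ℤ.[n/d]*d≤n n (+ suc d-1))))

floor-> : ∀ p → p ℚ.< ℚ.floor p ℚ./ 1 ℚ.+ 1ℚ
floor-> p@(ℚ.mkℚ n d-1 _) = subst (p ℚ.<_)
  (trans (sym (/1≡mkℚ k)) (trans (cong (ℚ._/ 1) k≡) (/1-+ (ℚ.floor p) (+ 1))))
  (ℚ.*<* (subst (ℤ._< k ℤ.* + suc d-1) (sym (ℤ.*-identityʳ n)) (ℤ.n<s[n/ℕd]*d n (suc d-1))))
  where
  k = ℤ.suc (n ℤ./ℕ suc d-1)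
  k≡ : k ≡ ℚ.floor p ℤ.+ + 1
  k≡ = trans (cong ℤ.suc (sym (ℤ.div-pos-is-/ℕ n (suc d-1)))) (ℤ.+-comm (+ 1) (ℚ.floor p))

hasFloor : ∀ x → (∀ m → x # fromℤ m) → ∃ λ m → IsFloor m x
hasFloor x x#ℤ = go (x#ℤ f) (x#ℤ (f ℤ.+ + 1))
  where
  N = proj₁ (cauchy x ½ 0<½)
  f = ℚ.floor (seq x N)
  F = f ℚ./ 1
  lower : ∀ n → N ℕ.≤ n → F ℚ.< seq x n ℚ.+ ½
  lower n N≤n = ℚ.≤-<-trans (floor-≤ (seq x N))
    (near⇒> (seq x n) (seq x N) (proj₂ (cauchy x ½ 0<½) n N N≤n ℕ.≤-refl))
  upper : ∀ n → N ℕ.≤ n → seq x n ℚ.< F ℚ.+ 1ℚ ℚ.+ ½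
  upper n N≤n = ℚ.<-trans
    (near⇒< (seq x n) (seq x N) (proj₂ (cauchy x ½ 0<½) n N N≤n ℕ.≤-refl))
    (ℚ.+-monoˡ-< ½ (floor-> (seq x N)))
  f-1+1≡f : f ℤ.- + 1 ℤ.+ + 1 ≡ f
  f-1+1≡f = trans (ℤ.+-assoc f (ℤ.- (+ 1)) (+ 1)) (ℤ.+-identityʳ f)
  f+1+1≡ : (f ℤ.+ + 1 ℤ.+ + 1) ℚ./ 1 ≡ F ℚ.+ 1ℚ ℚ.+ 1ℚ
  f+1+1≡ = trans (/1-+ (f ℤ.+ + 1) (+ 1)) (cong (ℚ._+ 1ℚ) (/1-+ f (+ 1)))
  go : x # fromℤ f → x # fromℤ (f ℤ.+ + 1) → ∃ λ m → IsFloor m x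
  go (inj₁ x<f) _ = f ℤ.- + 1
    , fromℚ-≤ ((f ℤ.- + 1) ℚ./ 1) x (N , λ n N≤n → ℚ.<⇒≤ (ℚ.<-trans
        (subst (ℚ._< F ℚ.- ½) (sym (/1-+ f (ℤ.- (+ 1)))) (ℚ.+-monoʳ-< F (ℚ.neg-antimono-< ½<1)))
        (shift< (lower n N≤n)
          (solve 2 (λ F a → a :+ con ½ :- F := a :- (F :- con ½)) refl F (seq x n)))))
    , subst (λ m → x < fromℤ m) (sym f-1+1≡f) x<f
    where
    ½<1 : ½ ℚ.< 1ℚ
    ½<1 = ℚ.*<* (ℤ.+<+ (ℕ.s≤s (ℕ.s≤s ℕ.z≤n)))
  go (inj₂ f<x) (inj₁ x<f+1) = f , fromℚ-<⇒≤ F x f<x , x<f+1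
  go (inj₂ _) (inj₂ f+1<x) = f ℤ.+ + 1
    , fromℚ-<⇒≤ ((f ℤ.+ + 1) ℚ./ 1) x f+1<x
    , ½ , 0<½ , N , λ n N≤n → subst (seq x n ℚ.+ ½ ℚ.≤_) (sym f+1+1≡) (ℚ.<⇒≤
        (shift< (upper n N≤n)
          (solve 2 (λ F a → F :+ con 1ℚ :+ con ½ :- a := F :+ con 1ℚ :+ con 1ℚ :- (a :+ con ½))
            refl F (seq x n))))

⌊_,_⌋ : (x : ℝ) → Irrational x → ℤ
⌊ x , irr ⌋ = proj₁ (hasFloor x (λ m → irr (m ℚ./ 1)))

isFloor : ∀ x irr → IsFloor ⌊ x , irr ⌋ x
isFloor x irr = proj₂ (hasFloor x (λ m → irr (m ℚ./ 1)))

irrational⇒nonZero : ∀ {x} → Irrational x → NonZero x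
irrational⇒nonZero irr = mkNonZero (irr 0ℚ)

sub-irrational : ∀ x m → Irrational x → Irrational (x - fromℤ m)
sub-irrational x m irr r with #⇒separated x (fromℚ (m ℚ./ 1 ℚ.+ r)) (irr (m ℚ./ 1 ℚ.+ r))
... | ε , 0<ε , N , far = separated⇒# (x - fromℤ m) (fromℚ r) (ε , 0<ε , N , λ n N≤n →
  subst (λ p → ε ℚ.≤ ℚ.∣ p ∣)
    (solve 3 (λ a m r → a :- (m :+ r) := a :+ (:- m) :- r) refl (seq x n) (m ℚ./ 1) r) (far n N≤n))

1-r*x-away : ∀ x → Irrational x → ∀ r → AwayFrom0 (λ n → 1ℚ ℚ.- r ℚ.* seq x n)
1-r*x-away x irr r with r ℚ.≟ 0ℚ
... | yes refl = 1ℚ , 0<1 , 0 , λ n _ → ℚ.≤-reflexive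
  (sym (cong ℚ.∣_∣ (solve 1 (λ a → con 1ℚ :- con 0ℚ :* a := con 1ℚ) refl (seq x n))))
... | no r≢0 with #⇒separated x (fromℚ (inv r)) (irr (inv r))
... | ε , 0<ε , N , far = ℚ.∣ r ∣ ℚ.* ε , *-pos 0<∣r∣ 0<ε , N , λ n N≤n →
  subst (ℚ.∣ r ∣ ℚ.* ε ℚ.≤_) (eq (seq x n))
    (ℚ.*-monoˡ-≤-nonNeg ℚ.∣ r ∣ {{ℚ.∣-∣-nonNeg r}} (far n N≤n))
  where
  0<∣r∣ : 0ℚ ℚ.< ℚ.∣ r ∣
  0<∣r∣ = ℚ.≰⇒> λ ∣r∣≤0 → r≢0 (ℚ.∣p∣≡0⇒p≡0 r (ℚ.≤-antisym ∣r∣≤0 (ℚ.0≤∣p∣ r)))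
  eq : ∀ a → ℚ.∣ r ∣ ℚ.* ℚ.∣ a ℚ.- inv r ∣ ≡ ℚ.∣ 1ℚ ℚ.- r ℚ.* a ∣
  eq a = begin
    ℚ.∣ r ∣ ℚ.* ℚ.∣ a ℚ.- inv r ∣   ≡⟨ ℚ.∣p*q∣≡∣p∣*∣q∣ r (a ℚ.- inv r) ⟨
    ℚ.∣ r ℚ.* (a ℚ.- inv r) ∣       ≡⟨ cong ℚ.∣_∣ (solve 3 (λ r a i → r :* (a :- i) := r :* a :- r :* i) refl r a (inv r)) ⟩
    ℚ.∣ r ℚ.* a ℚ.- r ℚ.* inv r ∣   ≡⟨ cong (λ i → ℚ.∣ r ℚ.* a ℚ.- i ∣) (inv-inverseʳ r≢0) ⟩
    ℚ.∣ r ℚ.* a ℚ.- 1ℚ ∣            ≡⟨ ∣p-q∣≡∣q-p∣ (r ℚ.* a) 1ℚ ⟩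
    ℚ.∣ 1ℚ ℚ.- r ℚ.* a ∣            ∎
    where open ≡-Reasoning

inv-far : ∀ a r {B e δ} → 0ℚ ℚ.< B → B ℚ.* δ ≡ e → a ≢ 0ℚ → ℚ.∣ a ∣ ℚ.≤ B →
          e ℚ.≤ ℚ.∣ 1ℚ ℚ.- r ℚ.* a ∣ → δ ℚ.≤ ℚ.∣ inv a ℚ.- r ∣
inv-far a r {B} {e} {δ} 0<B Bδ≡e a≢0 a≤B e≤ = ℚ.≮⇒≥ λ lt → ℚ.<⇒≢ (begin-strict
  ℚ.∣ 1ℚ ℚ.- r ℚ.* a ∣
    ≡⟨ cong (λ i → ℚ.∣ i ℚ.- r ℚ.* a ∣) (inv-inverseʳ a≢0) ⟨
  ℚ.∣ a ℚ.* inv a ℚ.- r ℚ.* a ∣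
    ≡⟨ cong ℚ.∣_∣ (solve 3 (λ a i r → a :* i :- r :* a := a :* (i :- r)) refl a (inv a) r) ⟩
  ℚ.∣ a ℚ.* (inv a ℚ.- r) ∣
    ≡⟨ ℚ.∣p*q∣≡∣p∣*∣q∣ a (inv a ℚ.- r) ⟩
  ℚ.∣ a ∣ ℚ.* ℚ.∣ inv a ℚ.- r ∣
    <⟨ *-mono-≤-< 0<B (ℚ.0≤∣p∣ (inv a ℚ.- r)) a≤B lt ⟩
  B ℚ.* δ
    ≡⟨ Bδ≡e ⟩
  e
    ≤⟨ e≤ ⟩
  ℚ.∣ 1ℚ ℚ.- r ℚ.* a ∣ ∎) refl
  where open ℚ.≤-Reasoning

⁻¹-irrational : ∀ x (irr : Irrational x) → Irrational ((x ⁻¹) {{irrational⇒nonZero irr}})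
⁻¹-irrational x irr r = separated⇒# ((x ⁻¹) {{irrational⇒nonZero irr}}) (fromℚ r)
  (go (cauchy⇒bounded (seq x) (cauchy x)) (away x {{irrational⇒nonZero irr}}) (1-r*x-away x irr r))
  where
  go : Bounded (seq x) → AwayFrom0 (seq x) → AwayFrom0 (λ n → 1ℚ ℚ.- r ℚ.* seq x n) →
       ∃ λ ε → 0ℚ ℚ.< ε × Eventually λ n → ε ℚ.≤ ℚ.∣ inv (seq x n) ℚ.- r ∣
  go (B , 0<B , L , ≤B) (c , 0<c , M , c≤) (e , 0<e , N , e≤) =
    let δ , 0<δ , Bδ≡e = share 0<B 0<e
        MN = M ℕ.⊔ N
    in δ , 0<δ , L ℕ.⊔ MN , λ n K≤n → let MN≤n = ℕ.m⊔n≤o⇒n≤o L MN K≤n in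
      inv-far (seq x n) r 0<B Bδ≡e
        (∣p∣≢0⇒p≢0 0<c (c≤ n (ℕ.m⊔n≤o⇒m≤o M N MN≤n)))
        (≤B n (ℕ.m⊔n≤o⇒m≤o L MN K≤n)) (e≤ n (ℕ.m⊔n≤o⇒n≤o M N MN≤n))

fractionalPart : ∀ x → Irrational x → ℝ
fractionalPart x irr = x - fromℤ ⌊ x , irr ⌋

fractionalPart-irrational : ∀ x irr → Irrational (fractionalPart x irr)
fractionalPart-irrational x irr = sub-irrational x ⌊ x , irr ⌋ irr

gauss : ∃ Irrational → ∃ Irrational
gauss (x , irr) = (t ⁻¹) {{irrational⇒nonZero t-irr}} , ⁻¹-irrational t t-irr
  where
  t     = fractionalPart x irr
  t-irr = fractionalPart-irrational x irr

completeQuotient : ∃ Irrational → ℕ → ∃ Irrational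
completeQuotient ξ zero    = ξ
completeQuotient ξ (suc n) = gauss (completeQuotient ξ n)

partialQuotient : ∃ Irrational → ℕ → ℤ
partialQuotient ξ n = let x , irr = completeQuotient ξ n in ⌊ x , irr ⌋

-- The convergents of [a₀; a₁, a₂, …]. They are in lowest terms by
-- coprime-convergent, and q > 0 by 1≤denominator.
numerators denominators : (ℕ → ℤ) → ℕ → ℤ
numerators a 0             = a 0
numerators a 1             = a 1 ℤ.* a 0 ℤ.+ + 1
numerators a (suc (suc n)) = a (suc (suc n)) ℤ.* numerators a (suc n) ℤ.+ numerators a n

denominators a 0             = + 1
denominators a 1             = a 1
denominators a (suc (suc n)) = a (suc (suc n)) ℤ.* denominators a (suc n) ℤ.+ denominators a n

numerator denominator : (ξ : ℝ) → Irrational ξ → ℕ → ℤ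
numerator   ξ irr = numerators   (partialQuotient (ξ , irr))
denominator ξ irr = denominators (partialQuotient (ξ , irr))

coprime-convergent : ∀ a n → Coprime (numerators a n) (denominators a n)
coprime-convergent a n {d} (d∣p , d∣q) = ∣1⇒≡1 (subst (d ∣ℕ_) (∣det∣≡1 n) (ℤ∣.∣⇒∣ᵤ d∣det))
  where
  open import Data.Nat.Divisibility using (∣1⇒≡1) renaming (_∣_ to _∣ℕ_)
  module S = ℤSolver.+-*-Solver
  p = numerators a
  q = denominators a
  det : ℕ → ℤ
  det n = p (suc n) ℤ.* q n ℤ.- p n ℤ.* q (suc n)
  det-suc : ∀ n → det (suc n) ≡ ℤ.- det n
  det-suc n = S.solve 5
    (λ c p₀ p₁ q₀ q₁ → (c S.:* p₁ S.:+ p₀) S.:* q₁ S.:- p₁ S.:* (c S.:* q₁ S.:+ q₀)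
                  S.:= S.:- (p₁ S.:* q₀ S.:- p₀ S.:* q₁))
    refl (a (suc (suc n))) (p n) (p (suc n)) (q n) (q (suc n))
  det-zero : det 0 ≡ + 1
  det-zero = S.solve 2
    (λ a₀ a₁ → (a₁ S.:* a₀ S.:+ S.con (+ 1)) S.:* S.con (+ 1) S.:- a₀ S.:* a₁ S.:= S.con (+ 1))
    refl (a 0) (a 1)
  ∣det∣≡1 : ∀ n → ℤ.∣ det n ∣ ≡ 1
  ∣det∣≡1 zero    = cong ℤ.∣_∣ det-zero
  ∣det∣≡1 (suc n) = trans (cong ℤ.∣_∣ (det-suc n)) (trans (ℤ.∣-i∣≡∣i∣ (det n)) (∣det∣≡1 n))
  d∣det : + d ∣ℤ det n
  d∣det = ℤ∣.∣m∣n⇒∣m-n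
    (ℤ∣.∣n⇒∣m*n (p (suc n)) {q n} (ℤ∣.∣ᵤ⇒∣ d∣q))
    (ℤ∣.∣m⇒∣m*n {m = p n} (q (suc n)) (ℤ∣.∣ᵤ⇒∣ d∣p))

inv≮1 : ∀ t {ε} → 0ℚ ℚ.< t → t ℚ.< 1ℚ → 0ℚ ℚ.< ε → ¬ (inv t ℚ.+ ε ℚ.≤ 1ℚ)
inv≮1 t {ε} 0<t t<1 0<ε le = ℚ.<⇒≢ (begin-strict
  1ℚ             ≡⟨ inv-inverseʳ (pos⇒≢0 0<t) ⟨
  t ℚ.* inv t    ≤⟨ ℚ.*-monoˡ-≤-nonNeg t {{ℚ.nonNegative (ℚ.<⇒≤ 0<t)}} (p+ε≤q⇒p≤q (inv t) 1ℚ 0<ε le) ⟩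
  t ℚ.* 1ℚ       ≡⟨ ℚ.*-identityʳ t ⟩
  t              <⟨ t<1 ⟩
  1ℚ             ∎) refl
  where open ℚ.≤-Reasoning

gauss-floor : ∀ x irr m → x < fromℤ (⌊ x , irr ⌋ ℤ.+ + 1) → fractionalPart x irr # 0ℝ →
              IsFloor m (proj₁ (gauss (x , irr))) → + 1 ℤ.≤ m
gauss-floor x irr m _ (inj₁ (ε , 0<ε , N , t<0)) _ =
  contradiction (ε , 0<ε , N , λ n N≤n → shift≤ (t<0 n N≤n)
    (solve 3 (λ a e f → con 0ℚ :- (a :+ (:- f) :+ e) := f :- (a :+ e)) refl
      (seq x n) ε (⌊ x , irr ⌋ ℚ./ 1)))
    (proj₁ (isFloor x irr))
gauss-floor x irr m (δ , 0<δ , L , x<) (inj₂ (ε , 0<ε , M , 0<t)) (_ , η , 0<η , N , t⁻¹<) =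
  ℤ.≮⇒≥ λ m<1 → inv≮1 (seq t K)
    (ℚ.<-≤-trans 0<ε (subst (ℚ._≤ seq t K) (ℚ.+-identityˡ ε)
      (0<t K (ℕ.≤-trans (ℕ.m≤m⊔n M N) (ℕ.m≤n⊔m L (M ℕ.⊔ N))))))
    (shift< (ℚ.<-≤-trans (subst (ℚ._< seq x K ℚ.+ δ) (ℚ.+-identityʳ (seq x K)) (ℚ.+-monoʳ-< (seq x K) 0<δ))
        (subst (seq x K ℚ.+ δ ℚ.≤_) (/1-+ ⌊ x , irr ⌋ (+ 1)) (x< K (ℕ.m≤m⊔n L (M ℕ.⊔ N)))))
      (solve 2 (λ a f → f :+ con 1ℚ :- a := con 1ℚ :- (a :+ (:- f))) refl
        (seq x K) (⌊ x , irr ⌋ ℚ./ 1)))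
    0<η
    (ℚ.≤-trans (t⁻¹< K (ℕ.≤-trans (ℕ.m≤n⊔m M N) (ℕ.m≤n⊔m L (M ℕ.⊔ N))))
      (/1-mono-≤ (subst (ℤ._≤ + 1) (ℤ.+-comm (+ 1) m) (ℤ.i<j⇒suc[i]≤j m<1))))
  where
  t = fractionalPart x irr
  K = L ℕ.⊔ (M ℕ.⊔ N)

1≤partialQuotient : ∀ ξ n → + 1 ℤ.≤ partialQuotient ξ (suc n)
1≤partialQuotient ξ n = gauss-floor x irr (partialQuotient ξ (suc n))
  (proj₂ (isFloor x irr)) (fractionalPart-irrational x irr 0ℚ)
  (isFloor (proj₁ y) (proj₂ y))
  where
  x   = proj₁ (completeQuotient ξ n)
  irr = proj₂ (completeQuotient ξ n)
  y   = completeQuotient ξ (suc n)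

1≤denominator : ∀ ξ irr n → + 1 ℤ.≤ denominator ξ irr n
1≤denominator ξ irr n = proj₁ (both n)
  where
  a = partialQuotient (ξ , irr)
  q = denominators a
  step : ∀ {c i j} → + 1 ℤ.≤ c → + 1 ℤ.≤ i → + 1 ℤ.≤ j → + 1 ℤ.≤ c ℤ.* i ℤ.+ j
  step {ℤ.+[1+ c ]} {ℤ.+[1+ i ]} {ℤ.+[1+ j ]} _ _ _ = ℤ.+≤+ (ℕ.s≤s ℕ.z≤n)
  step {+ 0} (ℤ.+≤+ ())
  step {ℤ.+[1+ _ ]} {+ 0} _ (ℤ.+≤+ ())
  step {ℤ.+[1+ _ ]} {ℤ.+[1+ _ ]} {+ 0} _ _ (ℤ.+≤+ ())
  both : ∀ n → + 1 ℤ.≤ q n × + 1 ℤ.≤ q (suc n)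
  both zero    = ℤ.≤-refl , 1≤partialQuotient (ξ , irr) 0
  both (suc n) = let l , r = both n in r , step (1≤partialQuotient (ξ , irr) (suc n)) r l

denominator-nonZero : ∀ ξ irr n → ℤ.NonZero (denominator ξ irr n)
denominator-nonZero ξ irr n =
  ℤ.>-nonZero (ℤ.<-≤-trans (ℤ.+<+ (ℕ.s≤s ℕ.z≤n)) (1≤denominator ξ irr n))

ℝ² : Set
ℝ² = ℝ × ℝ

infixl 6 _-ᵥ_
infixr 7 _•_

_-ᵥ_ : ℝ² → ℝ² → ℝ²
(x₁ , x₂) -ᵥ (y₁ , y₂) = x₁ - y₁ , x₂ - y₂

‖_‖ : ℝ² → ℝ
‖ z₁ , z₂ ‖ = ∣ z₁ ∣ ⊔ ∣ z₂ ∣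

record SL₂ℤ : Set where
  field
    γ₁₁ γ₁₂ γ₂₁ γ₂₂ : ℤ
    det≡1 : γ₁₁ ℤ.* γ₂₂ ℤ.- γ₁₂ ℤ.* γ₂₁ ≡ + 1

_•_ : SL₂ℤ → ℝ² → ℝ²
γ • (x₁ , x₂) = fromℤ γ₁₁ * x₁ + fromℤ γ₁₂ * x₂ , fromℤ γ₂₁ * x₁ + fromℤ γ₂₂ * x₂
  where open SL₂ℤ γ

-- The norm |γ|.
maxEntry : SL₂ℤ → ℕ
maxEntry γ = ℤ.∣ γ₁₁ ∣ ℕ.⊔ ℤ.∣ γ₁₂ ∣ ℕ.⊔ ℤ.∣ γ₂₁ ∣ ℕ.⊔ ℤ.∣ γ₂₂ ∣
  where open SL₂ℤ γ

-- Let (n, m) be b times the first row of γ minus a times the second, and suppose that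
-- γ (ξ , 1) is within η = 1 / (4 b qₖ) of y. As b y₁ = a y₂, the form Λ = n ξ + m satisfies
-- qₖ |Λ| ≤ 2 b qₖ η = 1/2. By det γ = 1, n (γ₂₁ ξ + γ₂₂) = b + γ₂₁ Λ, and since γ₂₁ ξ + γ₂₂ is
-- nearly y₂ this gives |n| ≤ qₖ₊₁ / 3. With θ = qₖ ξ − pₖ, |θ| ≤ 1 / qₖ₊₁, the integer
-- t = n pₖ + m qₖ equals qₖ Λ − n θ, hence |t| < 1 and t = 0. So qₖ divides n, which is
-- nonzero; but now qₖ Λ = n θ is so small that the relation for n forces 19 |n| ≤ 3 qₖ.
--
-- The hypotheses leave room for fixed slacks, so the argument is run on rationals, at a
-- single late index of the Cauchy sequences: 1/2 becomes 5/8 and 12 b becomes 11 b.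
module Submission where

open import Defs
open import Data.Nat using (ℕ; suc) renaming (_≤_ to _≤ᴺ_)
open import Data.Integer using (ℤ; +_) renaming (∣_∣ to absℤ; _≤_ to _≤ᶻ_; NonZero to NonZeroᶻ)
open import Data.Integer.Coprimality using (Coprime)
open import Data.Product using (_,_)
open import Data.Nat using (zero)
import Data.Nat.Properties as ℕ
import Data.Nat.Base as ℕ
import Data.Nat.Divisibility as ℕ
import Data.Nat.Coprimality as ℕ
import Data.Integer.Base as ℤ
import Data.Integer.Properties as ℤ
open import Data.Integer.Coprimality using (coprime-divisor) renaming (sym to coprime-sym)
import Data.Integer.Solver as ℤSolver
import Data.Integer.Divisibility.Signed as ℤ
open import Data.Rational.Base as ℚ using (ℚ; 0ℚ; 1ℚ)
import Data.Rational.Properties as ℚ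
open import Data.Rational.Solver using (module +-*-Solver)
open import Data.Product using (_×_; proj₁; proj₂)
open import Data.Sum using (_⊎_; inj₁; inj₂)
open import Function using (_∘_)
open import Relation.Nullary using (¬_; contradiction)
open import Relation.Binary.PropositionalEquality

module S = ℤSolver.+-*-Solver
open +-*-Solver using (Polynomial; solve; _:=_; _:+_; _:*_; :-_; _:-_; con)

-- Integers inside the rationals.

ι : ℤ → ℚ
ι i = i ℚ./ 1

ι-* : ∀ i j → ι (i ℤ.* j) ≡ ι i ℚ.* ι j
ι-* i j = sym (cong₂ ℚ._*_ (/1≡mkℚ i) (/1≡mkℚ j))

ι-neg : ∀ i → ι (ℤ.- i) ≡ ℚ.- ι i
ι-neg i = trans (/1≡mkℚ (ℤ.- i)) (trans (lem i) (cong ℚ.-_ (sym (/1≡mkℚ i))))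
  where
  lem : ∀ i → ℚ.mkℚ (ℤ.- i) 0 (ℕ.sym (ℕ.1-coprimeTo _)) ≡ ℚ.- ℚ.mkℚ i 0 (ℕ.sym (ℕ.1-coprimeTo _))
  lem (+ zero)     = refl
  lem ℤ.+[1+ n ]   = refl
  lem ℤ.-[1+ n ]   = refl

ι-- : ∀ i j → ι (i ℤ.- j) ≡ ι i ℚ.- ι j
ι-- i j = trans (/1-+ i (ℤ.- j)) (cong (ι i ℚ.+_) (ι-neg j))

ι-∣∣ : ∀ i → ℚ.∣ ι i ∣ ≡ ι (+ absℤ i)
ι-∣∣ i = trans (cong ℚ.∣_∣ (/1≡mkℚ i)) (sym (/1≡mkℚ (+ absℤ i)))

∣ιi∣<1⇒i≡0 : ∀ i → ℚ.∣ ι i ∣ ℚ.< 1ℚ → i ≡ + 0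
∣ιi∣<1⇒i≡0 i lt = ℤ.∣i∣≡0⇒i≡0 (ℕ.n<1⇒n≡0 (ℕ.≰⇒> λ 1≤∣i∣ →
  ℚ.<-irrefl refl (ℚ.<-≤-trans (subst (ℚ._< 1ℚ) (ι-∣∣ i) lt) (/1-mono-≤ {+ 1} (ℤ.+≤+ 1≤∣i∣)))))

ι-cancel-≤ : ∀ {i j} → ι i ℚ.≤ ι j → i ℤ.≤ j
ι-cancel-≤ {i} {j} ιi≤ιj = subst₂ ℤ._≤_ (ℤ.*-identityʳ i) (ℤ.*-identityʳ j)
  (ℚ.drop-*≤* (subst₂ ℚ._≤_ (/1≡mkℚ i) (/1≡mkℚ j) ιi≤ιj))

-- Linear certificates and the numerical estimates.

infixr 7 _⊛_
infixl 6 _⊕_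

_⊕_ : ∀ {a b c d} → a ℚ.≤ b → c ℚ.≤ d → a ℚ.+ c ℚ.≤ b ℚ.+ d
_⊕_ = ℚ.+-mono-≤

_⊛_ : ∀ n {a b} → a ℚ.≤ b → ι (+ n) ℚ.* a ℚ.≤ ι (+ n) ℚ.* b
n ⊛ a≤b = ℚ.*-monoˡ-≤-nonNeg (ι (+ n)) {{ℚ.nonNegative (/1-mono-≤ {+ 0} {+ n} (ℤ.+≤+ ℕ.z≤n))}} a≤b

scale : ∀ {c a b} → 0ℚ ℚ.≤ c → a ℚ.≤ b → c ℚ.* a ℚ.≤ c ℚ.* b
scale {c} 0≤c = ℚ.*-monoˡ-≤-nonNeg c {{ℚ.nonNegative 0≤c}}

*-nonNeg : ∀ {p q} → 0ℚ ℚ.≤ p → 0ℚ ℚ.≤ q → 0ℚ ℚ.≤ p ℚ.* q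
*-nonNeg {p} {q} 0≤p 0≤q = subst (ℚ._≤ p ℚ.* q) (ℚ.*-zeroʳ p) (scale 0≤p 0≤q)

c : ∀ {m} → ℕ → Polynomial m
c n = con (ι (+ n))

-- The inequalities below are certified by a nonnegative combination of the hypotheses,
-- whose difference of sides is that of the goal by a ring identity (shift≤).

-- Here `q * η ≤ b * q * η ≤ 1 ≤ b ≤ q * Y / 11`, so passing from `Y` to `L` loses at most one
-- eleventh.
far-from-0 : ∀ {b q η Y L} → 0ℚ ℚ.≤ q → 0ℚ ℚ.≤ η → 1ℚ ℚ.≤ b → b ℚ.* q ℚ.* η ℚ.≤ 1ℚ →
             ι (+ 11) ℚ.* b ℚ.≤ q ℚ.* Y → Y ℚ.≤ L ℚ.+ η →
             ι (+ 10) ℚ.* (q ℚ.* Y) ℚ.≤ ι (+ 11) ℚ.* (q ℚ.* L)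
far-from-0 {b} {q} {η} {Y} {L} 0≤q 0≤η 1≤b bqη≤1 11b≤qY Y≤L+η = shift≤
  (11 ⊛ scale 0≤q Y≤L+η ⊕ 11b≤qY ⊕ 11 ⊛ scale (*-nonNeg 0≤q 0≤η) 1≤b ⊕ 11 ⊛ bqη≤1 ⊕ 11 ⊛ 1≤b)
  (solve 5 (λ b q η Y L →
     c 11 :* (q :* (L :+ η)) :+ q :* Y :+ c 11 :* (q :* η :* b) :+ c 11 :* c 1 :+ c 11 :* b
       :- (c 11 :* (q :* Y) :+ c 11 :* b :+ c 11 :* (q :* η :* c 1) :+ c 11 :* (b :* q :* η) :+ c 11 :* c 1)
     := c 11 :* (q :* L) :- c 10 :* (q :* Y)) refl b q η Y L)

-- On the right, `b * q` is at most `Z * q′ / 11` and `w * μ` at most `5/24 * Z * q′`. Dividing by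
-- `W`, which is at least `10/11 * Z`, gives `N ≤ 79/240 * q′`, just below one third; the last
-- summand of the certificate is the leftover.
coefficient-bound : ∀ {b q q′ w μ N W Z} →
  0ℚ ℚ.≤ N → 0ℚ ℚ.≤ w → 0ℚ ℚ.≤ q → 0ℚ ℚ.≤ q′ → 0ℚ ℚ.< Z → q ℚ.≤ q′ → ι (+ 11) ℚ.* b ℚ.≤ Z →
  ι (+ 10) ℚ.* Z ℚ.≤ ι (+ 11) ℚ.* W → ι (+ 3) ℚ.* w ℚ.≤ Z ℚ.* q′ → ι (+ 8) ℚ.* μ ℚ.≤ ι (+ 5) →
  N ℚ.* W ℚ.≤ b ℚ.* q ℚ.+ w ℚ.* μ → ι (+ 3) ℚ.* N ℚ.≤ q′
coefficient-bound {b} {q} {q′} {w} {μ} {N} {W} {Z}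
  0≤N 0≤w 0≤q 0≤q′ 0<Z q≤q′ 11b≤Z 10Z≤11W 3w≤Zq′ 8μ≤5 NW≤ =
  ℚ.*-cancelˡ-≤-pos (ι (+ 80) ℚ.* Z) {{ℚ.positive (*-pos (ℚ.positive⁻¹ (ι (+ 80))) 0<Z)}} (shift≤
    (24 ⊛ scale 0≤N 10Z≤11W ⊕ 264 ⊛ NW≤ ⊕ 33 ⊛ scale 0≤w 8μ≤5 ⊕ 55 ⊛ 3w≤Zq′
      ⊕ 24 ⊛ scale 0≤q 11b≤Z ⊕ 24 ⊛ scale 0≤Z q≤q′ ⊕ *-nonNeg 0≤Z 0≤q′)
    (solve 8 (λ b q q′ w μ N W Z →
      c 24 :* (N :* (c 11 :* W)) :+ c 264 :* (b :* q :+ w :* μ) :+ c 33 :* (w :* c 5)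
        :+ c 55 :* (Z :* q′) :+ c 24 :* (q :* Z) :+ c 24 :* (Z :* q′) :+ Z :* q′
      :- (c 24 :* (N :* (c 10 :* Z)) :+ c 264 :* (N :* W) :+ c 33 :* (w :* (c 8 :* μ))
        :+ c 55 :* (c 3 :* w) :+ c 24 :* (q :* (c 11 :* b)) :+ c 24 :* (Z :* q) :+ c 0)
      := c 80 :* Z :* q′ :- c 80 :* Z :* (c 3 :* N)) refl b q q′ w μ N W Z))
  where 0≤Z = ℚ.<⇒≤ 0<Z

-- The two terms are at most 5/8 and 1/3, with sum 23/24.
cross-term<1 : ∀ {τ μ N θ q′} → 0ℚ ℚ.≤ θ → ι (+ 8) ℚ.* μ ℚ.≤ ι (+ 5) → ι (+ 3) ℚ.* N ℚ.≤ q′ →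
               q′ ℚ.* θ ℚ.≤ 1ℚ → τ ℚ.≤ μ ℚ.+ N ℚ.* θ → τ ℚ.< 1ℚ
cross-term<1 {τ} {μ} {N} {θ} {q′} 0≤θ 8μ≤5 3N≤q′ q′θ≤1 τ≤ = ℚ.≰⇒> λ 1≤τ → ℚ.<-irrefl refl (ℚ.<-≤-trans 0<1 (shift≤
  (24 ⊛ 1≤τ ⊕ 24 ⊛ τ≤ ⊕ 3 ⊛ 8μ≤5 ⊕ 8 ⊛ scale 0≤θ 3N≤q′ ⊕ 8 ⊛ q′θ≤1)
  (solve 5 (λ τ μ N θ q′ →
    c 24 :* τ :+ c 24 :* (μ :+ N :* θ) :+ c 3 :* c 5 :+ c 8 :* (θ :* q′) :+ c 8 :* c 1
    :- (c 24 :* c 1 :+ c 24 :* τ :+ c 3 :* (c 8 :* μ) :+ c 8 :* (θ :* (c 3 :* N)) :+ c 8 :* (q′ :* θ))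
    := c 0 :- c 1) refl τ μ N θ q′)))

-- With `N * θ` in place of `μ`, the term in `w` is at most `N * Z / 3` and is absorbed on the left:
-- 10/11 - 1/3 = 19/33 remains against 1/11 = 3/33.
coefficient-bound-degenerate : ∀ {b q q′ w N W Z θ} →
  0ℚ ℚ.≤ N → 0ℚ ℚ.≤ q → 0ℚ ℚ.≤ θ → 0ℚ ℚ.< Z → ι (+ 11) ℚ.* b ℚ.≤ Z →
  ι (+ 10) ℚ.* Z ℚ.≤ ι (+ 11) ℚ.* W → ι (+ 3) ℚ.* w ℚ.≤ Z ℚ.* q′ → q′ ℚ.* θ ℚ.≤ 1ℚ →
  N ℚ.* W ℚ.≤ b ℚ.* q ℚ.+ w ℚ.* (N ℚ.* θ) → ι (+ 19) ℚ.* N ℚ.≤ ι (+ 3) ℚ.* q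
coefficient-bound-degenerate {b} {q} {q′} {w} {N} {W} {Z} {θ} 0≤N 0≤q 0≤θ 0<Z 11b≤Z 10Z≤11W 3w≤Zq′ q′θ≤1 NW≤ =
  ℚ.*-cancelˡ-≤-pos Z {{ℚ.positive 0<Z}} (shift≤
    (3 ⊛ scale 0≤N 10Z≤11W ⊕ 33 ⊛ NW≤ ⊕ 11 ⊛ scale (*-nonNeg 0≤N 0≤θ) 3w≤Zq′
      ⊕ 11 ⊛ scale (*-nonNeg 0≤N (ℚ.<⇒≤ 0<Z)) q′θ≤1 ⊕ 3 ⊛ scale 0≤q 11b≤Z)
    (solve 8 (λ b q q′ w N W Z θ →
      c 3 :* (N :* (c 11 :* W)) :+ c 33 :* (b :* q :+ w :* (N :* θ)) :+ c 11 :* (N :* θ :* (Z :* q′))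
        :+ c 11 :* (N :* Z :* c 1) :+ c 3 :* (q :* Z)
      :- (c 3 :* (N :* (c 10 :* Z)) :+ c 33 :* (N :* W) :+ c 11 :* (N :* θ :* (c 3 :* w))
        :+ c 11 :* (N :* Z :* (q′ :* θ)) :+ c 3 :* (q :* (c 11 :* b)))
      := Z :* (c 3 :* q) :- Z :* (c 19 :* N)) refl b q q′ w N W Z θ))

-- From real inequalities to rational ones at late indices.

infixr 4 _∧ₑ_

_∧ₑ_ : ∀ {P Q : ℕ → Set} → Eventually P → Eventually Q → Eventually (λ n → P n × Q n)
(M , p) ∧ₑ (N , q) = M ℕ.⊔ N , λ n K≤n →
  p n (ℕ.m⊔n≤o⇒m≤o M N K≤n) , q n (ℕ.m⊔n≤o⇒n≤o M N K≤n)

-- A violation by `ε` at one late index would persist by at least `ε / 2` at all later ones, because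
-- `x - y` is Cauchy, and that would be a witness of `y < x`. The order of ℚ is decidable, so the
-- refutation yields the inequality itself.
≤⇒eventually-≤ : ∀ x y {ε} → 0ℚ ℚ.< ε → x ≤ y → Eventually λ n → seq x n ℚ.≤ seq y n ℚ.+ ε
≤⇒eventually-≤ x y {ε} 0<ε x≤y = N , λ n N≤n → ℚ.≮⇒≥ λ y+ε<x → x≤y
  (δ , 0<δ , N , λ m N≤m → shift≤
    (ℚ.<⇒≤ y+ε<x ⊕ ℚ.<⇒≤ (near⇒> (d m) (d n) (close m n N≤m N≤n)) ⊕ ℚ.≤-reflexive (half+half ε))
    (solve 6 (λ x y x′ y′ e δ → x :+ (x′ :- y′ :+ δ) :+ e :- (y :+ e :+ (x :- y) :+ (δ :+ δ))
      := x′ :- (y′ :+ δ)) refl (seq x n) (seq y n) (seq x m) (seq y m) ε δ))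
  where
  d = seq (x - y)
  δ = half ε
  0<δ : 0ℚ ℚ.< δ
  0<δ = half-pos 0<ε
  N = proj₁ (cauchy (x - y) δ 0<δ)
  close = proj₂ (cauchy (x - y) δ 0<δ)

-- Errors of convergents, with `x n` standing for a rational approximation to the complete quotient
-- of index `n`.

module _ (a : ℕ → ℤ) (x : ℕ → ℚ) where

  private
    p q : ℕ → ℤ
    p = numerators a
    q = denominators a

  frac error : ℕ → ℚ
  frac n  = x n ℚ.- ι (a n)
  error n = ι (q n) ℚ.* x 0 ℚ.- ι (p n)

  -- The error is multiplied by − frac (suc n) when passing to the next convergent,
  -- which keeps this product constant.
  ErrorIdentity : ℕ → Set
  ErrorIdentity n = error (suc n) ≡ ℚ.- frac (suc n) ℚ.* error n ×
    ℚ.∣ error n ∣ ℚ.* (ι (q (suc n)) ℚ.+ frac (suc n) ℚ.* ι (q n)) ≡ 1ℚ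

  errorIdentity-zero : 0ℚ ℚ.< frac 0 → frac 0 ℚ.* x 1 ≡ 1ℚ → ErrorIdentity 0
  errorIdentity-zero 0<f fx≡1 = step , size
    where
    open ≡-Reasoning
    a₀ = ι (a 0)
    a₁ = ι (a 1)
    step : error 1 ≡ ℚ.- frac 1 ℚ.* error 0
    step = begin
      a₁ ℚ.* x 0 ℚ.- ι (a 1 ℤ.* a 0 ℤ.+ + 1)
        ≡⟨ cong (λ r → a₁ ℚ.* x 0 ℚ.- r)
             (trans (/1-+ (a 1 ℤ.* a 0) (+ 1)) (cong (ℚ._+ 1ℚ) (ι-* (a 1) (a 0)))) ⟩
      a₁ ℚ.* x 0 ℚ.- (a₁ ℚ.* a₀ ℚ.+ 1ℚ)
        ≡⟨ cong (λ r → a₁ ℚ.* x 0 ℚ.- (a₁ ℚ.* a₀ ℚ.+ r)) fx≡1 ⟨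
      a₁ ℚ.* x 0 ℚ.- (a₁ ℚ.* a₀ ℚ.+ (x 0 ℚ.- a₀) ℚ.* x 1)
        ≡⟨ solve 4 (λ x₀ x₁ a₀ a₁ → a₁ :* x₀ :- (a₁ :* a₀ :+ (x₀ :- a₀) :* x₁)
             := :- (x₁ :- a₁) :* (c 1 :* x₀ :- a₀)) refl (x 0) (x 1) a₀ a₁ ⟩
      ℚ.- frac 1 ℚ.* error 0 ∎
    size : ℚ.∣ error 0 ∣ ℚ.* (a₁ ℚ.+ frac 1 ℚ.* 1ℚ) ≡ 1ℚ
    size = begin
      ℚ.∣ error 0 ∣ ℚ.* (a₁ ℚ.+ frac 1 ℚ.* 1ℚ)
        ≡⟨ cong (λ r → ℚ.∣ r ℚ.- a₀ ∣ ℚ.* (a₁ ℚ.+ frac 1 ℚ.* 1ℚ)) (ℚ.*-identityˡ (x 0)) ⟩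
      ℚ.∣ frac 0 ∣ ℚ.* (a₁ ℚ.+ frac 1 ℚ.* 1ℚ)
        ≡⟨ cong₂ ℚ._*_ (ℚ.0≤p⇒∣p∣≡p (ℚ.<⇒≤ 0<f))
             (solve 2 (λ x₁ a₁ → a₁ :+ (x₁ :- a₁) :* c 1 := x₁) refl (x 1) a₁) ⟩
      frac 0 ℚ.* x 1
        ≡⟨ fx≡1 ⟩
      1ℚ ∎

  -- The recurrences give `θ₂ = a₂ * θ₁ + θ₀`, and `f₁ * x₂ ≡ 1` turns the previous step into
  -- `θ₀ = - x₂ * θ₁`. For the product, `q₂ + f₂ * q₁` equals `x₂ * q₁ + q₀`, and the factor `f₁` of
  -- the new error turns this into `q₁ + f₁ * q₀`.
  errorIdentity-suc : ∀ n → 0ℚ ℚ.< frac (suc n) → frac (suc n) ℚ.* x (suc (suc n)) ≡ 1ℚ →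
                      ErrorIdentity n → ErrorIdentity (suc n)
  errorIdentity-suc n 0<f fx≡1 (step , size) = step′ , size′
    where
    open ≡-Reasoning
    f₁ = frac (suc n)
    f₂ = frac (suc (suc n))
    x₂ = x (suc (suc n))
    a₂ = ι (a (suc (suc n)))
    θ₀ = error n
    θ₁ = error (suc n)
    q₀ = ι (q n)
    q₁ = ι (q (suc n))
    p₀ = ι (p n)
    p₁ = ι (p (suc n))
    recurrence : ∀ (r : ℕ → ℤ) → ι (a (suc (suc n)) ℤ.* r (suc n) ℤ.+ r n) ≡ a₂ ℚ.* ι (r (suc n)) ℚ.+ ι (r n)
    recurrence r = trans (/1-+ (a (suc (suc n)) ℤ.* r (suc n)) (r n))
      (cong (ℚ._+ ι (r n)) (ι-* (a (suc (suc n))) (r (suc n))))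
    step′ : error (suc (suc n)) ≡ ℚ.- f₂ ℚ.* θ₁
    step′ = begin
      ι (q (suc (suc n))) ℚ.* x 0 ℚ.- ι (p (suc (suc n)))
        ≡⟨ cong₂ (λ s t → s ℚ.* x 0 ℚ.- t) (recurrence q) (recurrence p) ⟩
      (a₂ ℚ.* q₁ ℚ.+ q₀) ℚ.* x 0 ℚ.- (a₂ ℚ.* p₁ ℚ.+ p₀)
        ≡⟨ solve 6 (λ a₂ q₁ q₀ p₁ p₀ x → (a₂ :* q₁ :+ q₀) :* x :- (a₂ :* p₁ :+ p₀)
             := a₂ :* (q₁ :* x :- p₁) :+ c 1 :* (q₀ :* x :- p₀)) refl a₂ q₁ q₀ p₁ p₀ (x 0) ⟩
      a₂ ℚ.* θ₁ ℚ.+ 1ℚ ℚ.* θ₀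
        ≡⟨ cong (λ r → a₂ ℚ.* θ₁ ℚ.+ r ℚ.* θ₀) fx≡1 ⟨
      a₂ ℚ.* θ₁ ℚ.+ f₁ ℚ.* x₂ ℚ.* θ₀
        ≡⟨ solve 5 (λ a₂ θ₁ f₁ x₂ θ₀ → a₂ :* θ₁ :+ f₁ :* x₂ :* θ₀
             := a₂ :* θ₁ :- x₂ :* (:- f₁ :* θ₀)) refl a₂ θ₁ f₁ x₂ θ₀ ⟩
      a₂ ℚ.* θ₁ ℚ.- x₂ ℚ.* (ℚ.- f₁ ℚ.* θ₀)
        ≡⟨ cong (λ r → a₂ ℚ.* θ₁ ℚ.- x₂ ℚ.* r) step ⟨
      a₂ ℚ.* θ₁ ℚ.- x₂ ℚ.* θ₁
        ≡⟨ solve 3 (λ a₂ x₂ θ₁ → a₂ :* θ₁ :- x₂ :* θ₁ := :- (x₂ :- a₂) :* θ₁) refl a₂ x₂ θ₁ ⟩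
      ℚ.- f₂ ℚ.* θ₁ ∎
    ∣θ₁∣ : ℚ.∣ θ₁ ∣ ≡ f₁ ℚ.* ℚ.∣ θ₀ ∣
    ∣θ₁∣ = begin
      ℚ.∣ θ₁ ∣                    ≡⟨ cong ℚ.∣_∣ step ⟩
      ℚ.∣ ℚ.- f₁ ℚ.* θ₀ ∣         ≡⟨ ℚ.∣p*q∣≡∣p∣*∣q∣ (ℚ.- f₁) θ₀ ⟩
      ℚ.∣ ℚ.- f₁ ∣ ℚ.* ℚ.∣ θ₀ ∣   ≡⟨ cong (ℚ._* ℚ.∣ θ₀ ∣) (trans (ℚ.∣-p∣≡∣p∣ f₁) (ℚ.0≤p⇒∣p∣≡p (ℚ.<⇒≤ 0<f))) ⟩
      f₁ ℚ.* ℚ.∣ θ₀ ∣             ∎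
    size′ : ℚ.∣ θ₁ ∣ ℚ.* (ι (q (suc (suc n))) ℚ.+ f₂ ℚ.* q₁) ≡ 1ℚ
    size′ = begin
      ℚ.∣ θ₁ ∣ ℚ.* (ι (q (suc (suc n))) ℚ.+ f₂ ℚ.* q₁)
        ≡⟨ cong₂ (λ r s → r ℚ.* (s ℚ.+ f₂ ℚ.* q₁)) ∣θ₁∣ (recurrence q) ⟩
      f₁ ℚ.* ℚ.∣ θ₀ ∣ ℚ.* (a₂ ℚ.* q₁ ℚ.+ q₀ ℚ.+ f₂ ℚ.* q₁)
        ≡⟨ solve 6 (λ f₁ t a₂ q₁ q₀ x₂ → f₁ :* t :* (a₂ :* q₁ :+ q₀ :+ (x₂ :- a₂) :* q₁)
             := t :* (f₁ :* x₂ :* q₁ :+ f₁ :* q₀)) refl f₁ ℚ.∣ θ₀ ∣ a₂ q₁ q₀ x₂ ⟩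
      ℚ.∣ θ₀ ∣ ℚ.* (f₁ ℚ.* x₂ ℚ.* q₁ ℚ.+ f₁ ℚ.* q₀)
        ≡⟨ cong (λ r → ℚ.∣ θ₀ ∣ ℚ.* (r ℚ.+ f₁ ℚ.* q₀))
             (trans (cong (ℚ._* q₁) fx≡1) (ℚ.*-identityˡ q₁)) ⟩
      ℚ.∣ θ₀ ∣ ℚ.* (q₁ ℚ.+ f₁ ℚ.* q₀)
        ≡⟨ size ⟩
      1ℚ ∎

  -- The nonnegative term `frac (suc n) * q n` is dropped from the constant product.
  error-bound : ∀ n → 0ℚ ℚ.≤ ι (q n) → 0ℚ ℚ.< frac (suc n) → ErrorIdentity n →
                ι (q (suc n)) ℚ.* ℚ.∣ error n ∣ ℚ.≤ 1ℚ
  error-bound n 0≤q 0<f (_ , size) = subst (ι (q (suc n)) ℚ.* ℚ.∣ error n ∣ ℚ.≤_) size (shift≤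
    (*-nonNeg (ℚ.0≤∣p∣ (error n)) (*-nonNeg (ℚ.<⇒≤ 0<f) 0≤q))
    (solve 4 (λ t q₁ f q₀ → t :* (f :* q₀) :- c 0 := t :* (q₁ :+ f :* q₀) :- q₁ :* t) refl
      ℚ.∣ error n ∣ (ι (q (suc n))) (frac (suc n)) (ι (q n))))

denominators-mono : ∀ a → (∀ n → + 1 ℤ.≤ a (suc n)) → (∀ n → + 0 ℤ.≤ denominators a n) →
                    ∀ n → denominators a n ℤ.≤ denominators a (suc n)
denominators-mono a 1≤a 0≤q zero    = 1≤a 0
denominators-mono a 1≤a 0≤q (suc n) = begin
  q (suc n)                                ≡⟨ ℤ.*-identityˡ (q (suc n)) ⟨
  + 1 ℤ.* q (suc n)                        ≤⟨ ℤ.*-monoʳ-≤-nonNeg (q (suc n)) {{ℤ.nonNegative (0≤q (suc n))}} (1≤a (suc n)) ⟩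
  a (suc (suc n)) ℤ.* q (suc n)            ≡⟨ ℤ.+-identityʳ _ ⟨
  a (suc (suc n)) ℤ.* q (suc n) ℤ.+ + 0    ≤⟨ ℤ.+-monoʳ-≤ (a (suc (suc n)) ℤ.* q (suc n)) (0≤q n) ⟩
  a (suc (suc n)) ℤ.* q (suc n) ℤ.+ q n    ∎
  where
  open ℤ.≤-Reasoning
  q = denominators a

-- Complete quotients and convergents of an irrational number.

-- Apartness from 0 supplies a sign, and the floor excludes the negative one.
0<fractionalPart : ∀ x irr → fractionalPart x irr # 0ℝ →
                   Eventually λ n → 0ℚ ℚ.< seq x n ℚ.- ι ⌊ x , irr ⌋
0<fractionalPart x irr (inj₁ (ε , 0<ε , N , t<0)) = contradiction
  (ε , 0<ε , N , λ n N≤n → shift≤ (t<0 n N≤n)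
    (solve 3 (λ x e f → c 0 :- (x :- f :+ e) := f :- (x :+ e)) refl (seq x n) ε (ι ⌊ x , irr ⌋)))
  (proj₁ (isFloor x irr))
0<fractionalPart x irr (inj₂ (ε , 0<ε , N , 0<t)) = N , λ n N≤n →
  ℚ.<-≤-trans 0<ε (subst (ℚ._≤ seq x n ℚ.- ι ⌊ x , irr ⌋) (ℚ.+-identityˡ ε) (0<t n N≤n))

module _ (ξ : ℝ) (irr : Irrational ξ) where

  private
    a p q : ℕ → ℤ
    a = partialQuotient (ξ , irr)
    p = numerator ξ irr
    q = denominator ξ irr

    x : ℕ → ℕ → ℚ
    x m n = seq (proj₁ (completeQuotient (ξ , irr) n)) m

  0<frac : ∀ n → Eventually λ m → 0ℚ ℚ.< frac a (x m) n
  0<frac n = let y , y-irr = completeQuotient (ξ , irr) n in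
    0<fractionalPart y y-irr (fractionalPart-irrational y y-irr 0ℚ)

  -- `gauss` inverts the fractional part termwise, so `x m (suc n)` is by definition `inv` of
  -- `frac a (x m) n`.
  frac-inverse : ∀ m n → 0ℚ ℚ.< frac a (x m) n → frac a (x m) n ℚ.* x m (suc n) ≡ 1ℚ
  frac-inverse m n 0<f = inv-inverseʳ (pos⇒≢0 0<f)

  -- Only the finitely many fractional parts up to index `n` have to be positive at `m`, so one
  -- threshold suffices for each `n`.
  errorIdentity : ∀ n → Eventually λ m → ErrorIdentity a (x m) n
  errorIdentity zero    = mapEv (λ m 0<f → errorIdentity-zero a (x m) 0<f (frac-inverse m 0 0<f)) (0<frac 0)
  errorIdentity (suc n) = mapEv
    (λ m (id , 0<f) → errorIdentity-suc a (x m) n 0<f (frac-inverse m (suc n) 0<f) id)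
    (errorIdentity n ∧ₑ 0<frac (suc n))

  0≤denominator : ∀ n → + 0 ℤ.≤ q n
  0≤denominator n = ℤ.≤-trans (ℤ.+≤+ ℕ.z≤n) (1≤denominator ξ irr n)

  convergent-error : ∀ n → Eventually λ m →
    ι (q (suc n)) ℚ.* ℚ.∣ ι (q n) ℚ.* seq ξ m ℚ.- ι (p n) ∣ ℚ.≤ 1ℚ
  convergent-error n = mapEv
    (λ m (id , 0<f) → error-bound a (x m) n (/1-mono-≤ {+ 0} (0≤denominator n)) 0<f id)
    (errorIdentity n ∧ₑ 0<frac (suc n))

-- The contradiction at a single rational index.

1≰0 : ¬ (+ 1 ℤ.≤ + 0)
1≰0 (ℤ.+≤+ ())

1≤ι : ∀ {i} → + 1 ℤ.≤ i → 1ℚ ℚ.≤ ι i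
1≤ι = /1-mono-≤ {+ 1}

∣x+y∣≤ : ∀ x y z {b c} → z ≡ x ℚ.+ y → ℚ.∣ x ∣ ℚ.≤ b → ℚ.∣ y ∣ ℚ.≤ c → ℚ.∣ z ∣ ℚ.≤ b ℚ.+ c
∣x+y∣≤ x y _ refl ∣x∣≤b ∣y∣≤c = ℚ.≤-trans (ℚ.∣p+q∣≤∣p∣+∣q∣ x y) (∣x∣≤b ⊕ ∣y∣≤c)

∣p*q∣≤ : ∀ p q {b c} → ℚ.∣ p ∣ ℚ.≤ b → ℚ.∣ q ∣ ℚ.≤ c → ℚ.∣ p ℚ.* q ∣ ℚ.≤ b ℚ.* c
∣p*q∣≤ p q {b} {c} ∣p∣≤b ∣q∣≤c = subst (ℚ._≤ b ℚ.* c) (sym (ℚ.∣p*q∣≡∣p∣*∣q∣ p q))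
  (*-mono-≤ (ℚ.0≤∣p∣ p) (ℚ.≤-trans (ℚ.0≤∣p∣ q) ∣q∣≤c) ∣p∣≤b ∣q∣≤c)

module _ (γ : SL₂ℤ) (a b p q q′ : ℤ) (x y₁ y₂ η : ℚ) where

  open SL₂ℤ γ

  private
    A = ι a
    B = ι b
    P = ι p
    Q = ι q
    G₁₁ = ι γ₁₁
    G₁₂ = ι γ₁₂
    G₂₁ = ι γ₂₁
    G₂₂ = ι γ₂₂
    n m t : ℤ
    n = b ℤ.* γ₁₁ ℤ.- a ℤ.* γ₂₁
    m = b ℤ.* γ₁₂ ℤ.- a ℤ.* γ₂₂
    t = n ℤ.* p ℤ.+ m ℤ.* q
    d₁ d₂ e Λ L θ : ℚ
    d₁ = G₁₁ ℚ.* x ℚ.+ G₁₂ ℚ.- y₁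
    d₂ = G₂₁ ℚ.* x ℚ.+ G₂₂ ℚ.- y₂
    e = B ℚ.* y₁ ℚ.- A ℚ.* y₂
    Λ = ι n ℚ.* x ℚ.+ ι m
    L = G₂₁ ℚ.* x ℚ.+ G₂₂
    θ = Q ℚ.* x ℚ.- P
    ι-cross : ∀ i j k l → ι (i ℤ.* j ℤ.- k ℤ.* l) ≡ ι i ℚ.* ι j ℚ.- ι k ℚ.* ι l
    ι-cross i j k l = trans (ι-- (i ℤ.* j) (k ℤ.* l)) (cong₂ ℚ._-_ (ι-* i j) (ι-* k l))

  -- The rationals `x`, `y₁`, `y₂` approximate the real data, and `e` measures how far the
  -- approximations are from slope `a / b`. The bound on `G₂₁` is the norm condition with 1/4
  -- relaxed to 1/3.
  nearby-orbit-point-impossible : Coprime p q → + absℤ a ℤ.≤ b → + 1 ℤ.≤ b → + 1 ℤ.≤ q → q ℤ.≤ q′ →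
    ι (+ 4) ℚ.* B ℚ.* Q ℚ.* η ≡ 1ℚ → 0ℚ ℚ.≤ η →
    ℚ.∣ d₁ ∣ ℚ.≤ η → ℚ.∣ d₂ ∣ ℚ.≤ η →
    ι (+ 8) ℚ.* (Q ℚ.* ℚ.∣ e ∣) ℚ.≤ 1ℚ →
    ι (+ 11) ℚ.* B ℚ.≤ Q ℚ.* ℚ.∣ y₂ ∣ →
    ι (+ 3) ℚ.* ℚ.∣ G₂₁ ∣ ℚ.≤ Q ℚ.* ℚ.∣ y₂ ∣ ℚ.* ι q′ →
    ¬ (ι q′ ℚ.* ℚ.∣ θ ∣ ℚ.≤ 1ℚ)
  nearby-orbit-point-impossible cop ∣a∣≤b 1≤b 1≤q q≤q′ 4bqη≡1 0≤η ∣d₁∣≤η ∣d₂∣≤η 8qe≤1 11b≤Z 3w≤Zq′ q′θ≤1 =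
    ℤ.<-irrefl refl (ℤ.<-≤-trans 3q<19n 19n≤3q)
    where
    open ≡-Reasoning
    N Z W μ : ℚ
    N = ℚ.∣ ι n ∣
    Z = Q ℚ.* ℚ.∣ y₂ ∣
    W = Q ℚ.* ℚ.∣ L ∣
    μ = Q ℚ.* ℚ.∣ Λ ∣
    1≤B : 1ℚ ℚ.≤ B
    1≤B = 1≤ι 1≤b
    1≤Q : 1ℚ ℚ.≤ Q
    1≤Q = 1≤ι 1≤q
    0≤1 : 0ℚ ℚ.≤ 1ℚ
    0≤1 = ℚ.<⇒≤ 0<1
    0≤Q : 0ℚ ℚ.≤ Q
    0≤Q = ℚ.≤-trans 0≤1 1≤Q
    0≤B : 0ℚ ℚ.≤ B
    0≤B = ℚ.≤-trans 0≤1 1≤B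
    0<Z : 0ℚ ℚ.< Z
    0<Z = ℚ.<-≤-trans (ℚ.<-≤-trans (ℚ.positive⁻¹ (ι (+ 11))) (11 ⊛ 1≤B)) 11b≤Z
    ∣Q*_∣ : ∀ r → ℚ.∣ Q ℚ.* r ∣ ≡ Q ℚ.* ℚ.∣ r ∣
    ∣Q* r ∣ = trans (ℚ.∣p*q∣≡∣p∣*∣q∣ Q r) (cong (ℚ._* ℚ.∣ r ∣) (ℚ.0≤p⇒∣p∣≡p 0≤Q))
    Λ≡ : Λ ≡ (B ℚ.* d₁ ℚ.+ ℚ.- A ℚ.* d₂) ℚ.+ e
    Λ≡ = trans
      (cong₂ (λ r s → r ℚ.* x ℚ.+ s) (ι-cross b γ₁₁ a γ₂₁) (ι-cross b γ₁₂ a γ₂₂))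
      (solve 9 (λ A B g₁₁ g₁₂ g₂₁ g₂₂ x y₁ y₂ →
        (B :* g₁₁ :- A :* g₂₁) :* x :+ (B :* g₁₂ :- A :* g₂₂)
        := B :* (g₁₁ :* x :+ g₁₂ :- y₁) :+ (:- A) :* (g₂₁ :* x :+ g₂₂ :- y₂) :+ (B :* y₁ :- A :* y₂))
        refl A B G₁₁ G₁₂ G₂₁ G₂₂ x y₁ y₂)
    ∣Λ∣≤ : ℚ.∣ Λ ∣ ℚ.≤ B ℚ.* η ℚ.+ B ℚ.* η ℚ.+ ℚ.∣ e ∣
    ∣Λ∣≤ = ∣x+y∣≤ (B ℚ.* d₁ ℚ.+ ℚ.- A ℚ.* d₂) e Λ Λ≡
      (∣x+y∣≤ (B ℚ.* d₁) (ℚ.- A ℚ.* d₂) _ refl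
        (∣p*q∣≤ B d₁ (ℚ.≤-reflexive (ℚ.0≤p⇒∣p∣≡p 0≤B)) ∣d₁∣≤η)
        (∣p*q∣≤ (ℚ.- A) d₂ ∣A∣≤B ∣d₂∣≤η)) ℚ.≤-refl
      where
      ∣A∣≤B : ℚ.∣ ℚ.- A ∣ ℚ.≤ B
      ∣A∣≤B = subst (ℚ._≤ B) (sym (trans (ℚ.∣-p∣≡∣p∣ A) (ι-∣∣ a))) (/1-mono-≤ ∣a∣≤b)
    -- The distance to the orbit point contributes `16 * B * Q * η = 4`, and the slope defect `e` at
    -- most 1.
    8μ≤5 : ι (+ 8) ℚ.* μ ℚ.≤ ι (+ 5)
    8μ≤5 = shift≤ (8 ⊛ scale 0≤Q ∣Λ∣≤ ⊕ 8qe≤1 ⊕ 4 ⊛ ℚ.≤-reflexive 4bqη≡1)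
      (solve 5 (λ Q l B η e → c 8 :* (Q :* (B :* η :+ B :* η :+ e)) :+ c 1 :+ c 4 :* c 1
          :- (c 8 :* (Q :* l) :+ c 8 :* (Q :* e) :+ c 4 :* (c 4 :* B :* Q :* η))
        := c 5 :- c 8 :* (Q :* l)) refl Q ℚ.∣ Λ ∣ B η ℚ.∣ e ∣)
    bqη≤1 : B ℚ.* Q ℚ.* η ℚ.≤ 1ℚ
    bqη≤1 = shift≤ (3 ⊛ *-nonNeg (*-nonNeg 0≤B 0≤Q) 0≤η ⊕ ℚ.≤-reflexive 4bqη≡1)
      (solve 3 (λ B Q η → c 3 :* (B :* Q :* η) :+ c 1 :- (c 3 :* c 0 :+ c 4 :* B :* Q :* η)
        := c 1 :- B :* Q :* η) refl B Q η)
    10Z≤11W : ι (+ 10) ℚ.* Z ℚ.≤ ι (+ 11) ℚ.* W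
    10Z≤11W = far-from-0 0≤Q 0≤η 1≤B bqη≤1 11b≤Z
      (ℚ.≤-trans (∣p∣≤∣q∣+∣p-q∣ y₂ L)
        (ℚ.+-monoʳ-≤ ℚ.∣ L ∣ (subst (ℚ._≤ η) (∣p-q∣≡∣q-p∣ L y₂) ∣d₂∣≤η)))
    -- In `n * L - G₂₁ * Λ` the terms in `x` cancel, leaving `n * γ₂₂ - m * γ₂₁`, which is `b` times
    -- the determinant.
    nL≡ : ι n ℚ.* L ≡ B ℚ.+ G₂₁ ℚ.* Λ
    nL≡ = begin
      ι n ℚ.* L
        ≡⟨ cong (ℚ._* L) (ι-cross b γ₁₁ a γ₂₁) ⟩
      (B ℚ.* G₁₁ ℚ.- A ℚ.* G₂₁) ℚ.* L
        ≡⟨ solve 7 (λ A B g₁₁ g₁₂ g₂₁ g₂₂ x → (B :* g₁₁ :- A :* g₂₁) :* (g₂₁ :* x :+ g₂₂)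
             := B :* (g₁₁ :* g₂₂ :- g₁₂ :* g₂₁)
               :+ g₂₁ :* ((B :* g₁₁ :- A :* g₂₁) :* x :+ (B :* g₁₂ :- A :* g₂₂)))
             refl A B G₁₁ G₁₂ G₂₁ G₂₂ x ⟩
      B ℚ.* (G₁₁ ℚ.* G₂₂ ℚ.- G₁₂ ℚ.* G₂₁)
        ℚ.+ G₂₁ ℚ.* ((B ℚ.* G₁₁ ℚ.- A ℚ.* G₂₁) ℚ.* x ℚ.+ (B ℚ.* G₁₂ ℚ.- A ℚ.* G₂₂))
        ≡⟨ cong₂ ℚ._+_
             (trans (cong (B ℚ.*_) (trans (sym (ι-cross γ₁₁ γ₂₂ γ₁₂ γ₂₁)) (cong ι det≡1))) (ℚ.*-identityʳ B))
             (cong₂ (λ r s → G₂₁ ℚ.* (r ℚ.* x ℚ.+ s)) (sym (ι-cross b γ₁₁ a γ₂₁)) (sym (ι-cross b γ₁₂ a γ₂₂))) ⟩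
      B ℚ.+ G₂₁ ℚ.* Λ ∎
    -- The bound `r` is left open for two uses: first with `μ`, then, once `t` vanishes, with `N`
    -- times the absolute value of `θ`.
    NW≤ : ∀ {r} → ℚ.∣ Q ℚ.* Λ ∣ ℚ.≤ r → N ℚ.* W ℚ.≤ B ℚ.* Q ℚ.+ ℚ.∣ G₂₁ ∣ ℚ.* r
    NW≤ {r} QΛ≤r = subst (ℚ._≤ B ℚ.* Q ℚ.+ ℚ.∣ G₂₁ ∣ ℚ.* r)
      (trans (ℚ.∣p*q∣≡∣p∣*∣q∣ (ι n) (Q ℚ.* L)) (cong (N ℚ.*_) ∣Q* L ∣))
      (∣x+y∣≤ (B ℚ.* Q) (G₂₁ ℚ.* (Q ℚ.* Λ)) (ι n ℚ.* (Q ℚ.* L)) nQL≡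
        (ℚ.≤-reflexive (ℚ.0≤p⇒∣p∣≡p (*-nonNeg 0≤B 0≤Q)))
        (∣p*q∣≤ G₂₁ (Q ℚ.* Λ) ℚ.≤-refl QΛ≤r))
      where
      nQL≡ : ι n ℚ.* (Q ℚ.* L) ≡ B ℚ.* Q ℚ.+ G₂₁ ℚ.* (Q ℚ.* Λ)
      nQL≡ = begin
        ι n ℚ.* (Q ℚ.* L)
          ≡⟨ solve 3 (λ n Q L → n :* (Q :* L) := Q :* (n :* L)) refl (ι n) Q L ⟩
        Q ℚ.* (ι n ℚ.* L)
          ≡⟨ cong (Q ℚ.*_) nL≡ ⟩
        Q ℚ.* (B ℚ.+ G₂₁ ℚ.* Λ)
          ≡⟨ solve 4 (λ Q B g l → Q :* (B :+ g :* l) := B :* Q :+ g :* (Q :* l)) refl Q B G₂₁ Λ ⟩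
        B ℚ.* Q ℚ.+ G₂₁ ℚ.* (Q ℚ.* Λ) ∎
    3N≤q′ : ι (+ 3) ℚ.* N ℚ.≤ ι q′
    3N≤q′ = coefficient-bound {b = B} {w = ℚ.∣ G₂₁ ∣} {μ = μ} {N = N} (ℚ.0≤∣p∣ (ι n)) (ℚ.0≤∣p∣ G₂₁) 0≤Q (ℚ.≤-trans 0≤Q Q≤q′) 0<Z Q≤q′
      11b≤Z 10Z≤11W 3w≤Zq′ 8μ≤5 (NW≤ (ℚ.≤-reflexive ∣Q* Λ ∣))
      where
      Q≤q′ : Q ℚ.≤ ι q′
      Q≤q′ = /1-mono-≤ q≤q′
    ιt≡ : ι t ≡ ι n ℚ.* P ℚ.+ ι m ℚ.* Q
    ιt≡ = trans (/1-+ (n ℤ.* p) (m ℤ.* q)) (cong₂ ℚ._+_ (ι-* n p) (ι-* m q))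
    ιt≡QΛ-nθ : ι t ≡ Q ℚ.* Λ ℚ.+ ι n ℚ.* ℚ.- θ
    ιt≡QΛ-nθ = trans ιt≡ (solve 5 (λ n m P Q x → n :* P :+ m :* Q := Q :* (n :* x :+ m) :+ n :* (:- (Q :* x :- P)))
      refl (ι n) (ι m) P Q x)
    t≡0 : t ≡ + 0
    t≡0 = ∣ιi∣<1⇒i≡0 t (cross-term<1 {μ = μ} {N = N} (ℚ.0≤∣p∣ θ) 8μ≤5 3N≤q′ q′θ≤1
      (∣x+y∣≤ (Q ℚ.* Λ) (ι n ℚ.* ℚ.- θ) (ι t) ιt≡QΛ-nθ (ℚ.≤-reflexive ∣Q* Λ ∣)
        (∣p*q∣≤ (ι n) (ℚ.- θ) ℚ.≤-refl (ℚ.≤-reflexive (ℚ.∣-p∣≡∣p∣ θ)))))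
    QΛ≡nθ : Q ℚ.* Λ ≡ ι n ℚ.* θ
    QΛ≡nθ = begin
      Q ℚ.* Λ
        ≡⟨ solve 3 (λ l n θ → l := l :+ n :* (:- θ) :+ n :* θ) refl (Q ℚ.* Λ) (ι n) θ ⟩
      Q ℚ.* Λ ℚ.+ ι n ℚ.* ℚ.- θ ℚ.+ ι n ℚ.* θ
        ≡⟨ cong (ℚ._+ ι n ℚ.* θ) (trans (sym ιt≡QΛ-nθ) (cong ι t≡0)) ⟩
      0ℚ ℚ.+ ι n ℚ.* θ
        ≡⟨ ℚ.+-identityˡ (ι n ℚ.* θ) ⟩
      ι n ℚ.* θ ∎
    ι19n≤ι3q : ι (+ 19) ℚ.* N ℚ.≤ ι (+ 3) ℚ.* Q
    ι19n≤ι3q = coefficient-bound-degenerate {b = B} {w = ℚ.∣ G₂₁ ∣} {N = N} (ℚ.0≤∣p∣ (ι n)) 0≤Q (ℚ.0≤∣p∣ θ) 0<Z 11b≤Z 10Z≤11W 3w≤Zq′ q′θ≤1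
      (NW≤ (ℚ.≤-reflexive (trans (cong ℚ.∣_∣ QΛ≡nθ) (ℚ.∣p*q∣≡∣p∣*∣q∣ (ι n) θ))))
    19n≤3q : + 19 ℤ.* + absℤ n ℤ.≤ + 3 ℤ.* q
    19n≤3q = ι-cancel-≤ (subst₂ ℚ._≤_
      (trans (cong (ι (+ 19) ℚ.*_) (ι-∣∣ n)) (sym (ι-* (+ 19) (+ absℤ n)))) (sym (ι-* (+ 3) q)) ι19n≤ι3q)
    pn≡-mq : p ℤ.* n ≡ ℤ.- m ℤ.* q
    pn≡-mq = begin
      p ℤ.* n             ≡⟨ S.solve 4 (λ n p m q → p S.:* n S.:= (S.:- m) S.:* q S.:+ (n S.:* p S.:+ m S.:* q)) refl n p m q ⟩
      ℤ.- m ℤ.* q ℤ.+ t   ≡⟨ cong (λ r → ℤ.- m ℤ.* q ℤ.+ r) t≡0 ⟩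
      ℤ.- m ℤ.* q ℤ.+ + 0 ≡⟨ ℤ.+-identityʳ (ℤ.- m ℤ.* q) ⟩
      ℤ.- m ℤ.* q         ∎
    -- As a combination of `n` and `m`, the positive integer `b` prevents both from vanishing.
    b≡ : b ≡ n ℤ.* γ₂₂ ℤ.- m ℤ.* γ₂₁
    b≡ = begin
      b
        ≡⟨ ℤ.*-identityʳ b ⟨
      b ℤ.* + 1
        ≡⟨ cong (b ℤ.*_) det≡1 ⟨
      b ℤ.* (γ₁₁ ℤ.* γ₂₂ ℤ.- γ₁₂ ℤ.* γ₂₁)
        ≡⟨ S.solve 6 (λ a b g₁₁ g₁₂ g₂₁ g₂₂ → b S.:* (g₁₁ S.:* g₂₂ S.:- g₁₂ S.:* g₂₁)
             S.:= (b S.:* g₁₁ S.:- a S.:* g₂₁) S.:* g₂₂ S.:- (b S.:* g₁₂ S.:- a S.:* g₂₂) S.:* g₂₁)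
             refl a b γ₁₁ γ₁₂ γ₂₁ γ₂₂ ⟩
      n ℤ.* γ₂₂ ℤ.- m ℤ.* γ₂₁ ∎
    -- If `n` were 0, then `t ≡ 0` would leave `m * q ≡ 0`, hence `m ≡ 0` since `q` is positive.
    n≢0 : n ≢ + 0
    n≢0 n≡0 = m≢0 (ℤ.i*j≡0⇒i≡0∨j≡0 m {q} (trans (sym (ℤ.+-identityˡ (m ℤ.* q)))
      (trans (cong (λ r → r ℤ.* p ℤ.+ m ℤ.* q) (sym n≡0)) t≡0)))
      where
      m≢0 : ¬ (m ≡ + 0 ⊎ q ≡ + 0)
      m≢0 (inj₁ m≡0) = 1≰0 (subst (+ 1 ℤ.≤_) (trans b≡ (cong₂ (λ r s → r ℤ.* γ₂₂ ℤ.- s ℤ.* γ₂₁) n≡0 m≡0)) 1≤b)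
      m≢0 (inj₂ q≡0) = 1≰0 (subst (+ 1 ℤ.≤_) q≡0 1≤q)
    -- `q` divides `p * n` and is coprime to `p`, so it divides the nonzero `n`.
    q≤∣n∣ : q ℤ.≤ + absℤ n
    q≤∣n∣ = subst (ℤ._≤ + absℤ n) (ℤ.0≤i⇒+∣i∣≡i (ℤ.≤-trans (ℤ.+≤+ ℕ.z≤n) 1≤q))
      (ℤ.+≤+ (ℕ.∣⇒≤ {{ℕ.≢-nonZero (n≢0 ∘ ℤ.∣i∣≡0⇒i≡0)}}
        (coprime-divisor q p n (λ {i} → coprime-sym {p} {q} cop {i}) (ℤ.∣⇒∣ᵤ (ℤ.divides (ℤ.- m) pn≡-mq)))))
    3q<19n : + 3 ℤ.* q ℤ.< + 19 ℤ.* + absℤ n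
    3q<19n = ℤ.<-≤-trans 3q<19q 19q≤19n
      where
      3q<19q : + 3 ℤ.* q ℤ.< + 19 ℤ.* q
      3q<19q = ℤ.*-monoʳ-<-pos q {{ℤ.positive (ℤ.<-≤-trans (ℤ.+<+ (ℕ.s≤s ℕ.z≤n)) 1≤q)}} {+ 3} {+ 19}
        (ℤ.+<+ (ℕ.s≤s (ℕ.s≤s (ℕ.s≤s (ℕ.s≤s ℕ.z≤n)))))
      19q≤19n : + 19 ℤ.* q ℤ.≤ + 19 ℤ.* + absℤ n
      19q≤19n = ℤ.*-monoˡ-≤-nonNeg (+ 19) q≤∣n∣

-- Passing from the real hypotheses to rational ones.

0<∣p∣ : ∀ {p} → p ≢ 0ℚ → 0ℚ ℚ.< ℚ.∣ p ∣
0<∣p∣ {p} p≢0 = ℚ.≰⇒> λ ∣p∣≤0 → p≢0 (ℚ.∣p∣≡0⇒p≡0 p (ℚ.≤-antisym ∣p∣≤0 (ℚ.0≤∣p∣ p)))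

-- Multiplying the difference of slopes by `B * y₂` clears both denominators; the factor is at most
-- `B * C` in absolute value, and `δ` is the reciprocal of `8 * Q * B * C`.
slope-error : ∀ {A B y₁ y₂ Q C δ} → 0ℚ ℚ.< B → y₂ ≢ 0ℚ → 0ℚ ℚ.≤ Q → ℚ.∣ y₂ ∣ ℚ.≤ C →
              ι (+ 8) ℚ.* Q ℚ.* (B ℚ.* C) ℚ.* δ ≡ 1ℚ → ℚ.∣ y₁ ℚ.* inv y₂ ℚ.- A ℚ.* inv B ∣ ℚ.≤ δ →
              ι (+ 8) ℚ.* (Q ℚ.* ℚ.∣ B ℚ.* y₁ ℚ.- A ℚ.* y₂ ∣) ℚ.≤ 1ℚ
slope-error {A} {B} {y₁} {y₂} {Q} {C} {δ} 0<B y₂≢0 0≤Q ∣y₂∣≤C δ≡ near = shift≤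
  (8 ⊛ scale 0≤Q bound ⊕ ℚ.≤-reflexive δ≡)
  (solve 5 (λ e B C Q δ → c 8 :* (Q :* (B :* C :* δ)) :+ c 1 :- (c 8 :* (Q :* e) :+ c 8 :* Q :* (B :* C) :* δ)
    := c 1 :- c 8 :* (Q :* e)) refl ℚ.∣ B ℚ.* y₁ ℚ.- A ℚ.* y₂ ∣ B C Q δ)
  where
  D = y₁ ℚ.* inv y₂ ℚ.- A ℚ.* inv B
  eq : B ℚ.* y₂ ℚ.* D ≡ B ℚ.* y₁ ℚ.- A ℚ.* y₂
  eq = begin
    B ℚ.* y₂ ℚ.* D
      ≡⟨ solve 6 (λ A B y₁ y₂ i j → B :* y₂ :* (y₁ :* i :- A :* j) := B :* y₁ :* (y₂ :* i) :- A :* y₂ :* (B :* j))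
           refl A B y₁ y₂ (inv y₂) (inv B) ⟩
    B ℚ.* y₁ ℚ.* (y₂ ℚ.* inv y₂) ℚ.- A ℚ.* y₂ ℚ.* (B ℚ.* inv B)
      ≡⟨ cong₂ (λ r s → B ℚ.* y₁ ℚ.* r ℚ.- A ℚ.* y₂ ℚ.* s) (inv-inverseʳ y₂≢0) (inv-inverseʳ (pos⇒≢0 0<B)) ⟩
    B ℚ.* y₁ ℚ.* 1ℚ ℚ.- A ℚ.* y₂ ℚ.* 1ℚ
      ≡⟨ cong₂ ℚ._-_ (ℚ.*-identityʳ (B ℚ.* y₁)) (ℚ.*-identityʳ (A ℚ.* y₂)) ⟩
    B ℚ.* y₁ ℚ.- A ℚ.* y₂ ∎
    where open ≡-Reasoning
  bound : ℚ.∣ B ℚ.* y₁ ℚ.- A ℚ.* y₂ ∣ ℚ.≤ B ℚ.* C ℚ.* δ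
  bound = subst (λ r → ℚ.∣ r ∣ ℚ.≤ B ℚ.* C ℚ.* δ) eq
    (∣p*q∣≤ (B ℚ.* y₂) D (∣p*q∣≤ B y₂ (ℚ.≤-reflexive (ℚ.0≤p⇒∣p∣≡p (ℚ.<⇒≤ 0<B))) ∣y₂∣≤C) near)

-- After multiplication by `Y` the slack `δ` becomes at most `C * δ ≡ 1`, hence at most `B`: this
-- turns 12 into 11.
clear-denominator : ∀ {B Y Q C δ} → 1ℚ ℚ.≤ B → 0ℚ ℚ.< Y → 0ℚ ℚ.≤ δ → Y ℚ.≤ C → C ℚ.* δ ≡ 1ℚ →
                    ι (+ 12) ℚ.* B ℚ.* inv Y ℚ.≤ Q ℚ.+ δ → ι (+ 11) ℚ.* B ℚ.≤ Q ℚ.* Y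
clear-denominator {B} {Y} {Q} {C} {δ} 1≤B 0<Y 0≤δ Y≤C Cδ≡1 le = shift≤
  (scale (ℚ.<⇒≤ 0<Y) le ⊕ scale 0≤δ Y≤C ⊕ ℚ.≤-reflexive Cδ≡1 ⊕ 1≤B
    ⊕ 12 ⊛ ℚ.≤-reflexive (cong (B ℚ.*_) (sym (inv-inverseʳ (pos⇒≢0 0<Y)))))
  (solve 6 (λ B Y i Q C δ → Y :* (Q :+ δ) :+ δ :* C :+ c 1 :+ B :+ c 12 :* (B :* (Y :* i))
      :- (Y :* (c 12 :* B :* i) :+ δ :* Y :+ C :* δ :+ c 1 :+ c 12 :* (B :* c 1))
    := Q :* Y :- c 11 :* B) refl B Y (inv Y) Q C δ)

-- The additive slack 1/4 is at most `Q * Y * Q′ / 44`, as `1 ≤ B * Q′`. Altogether `w` is at most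
-- 3/11 of `Q * Y * Q′`, and 9/11 is below 1.
entry-bound : ∀ {B Y Q Q′ w} → 1ℚ ℚ.≤ B → 1ℚ ℚ.≤ Q′ → ι (+ 11) ℚ.* B ℚ.≤ Q ℚ.* Y →
              w ℚ.≤ Y ℚ.* inv (ι (+ 4)) ℚ.* Q ℚ.* Q′ ℚ.+ inv (ι (+ 4)) → ι (+ 3) ℚ.* w ℚ.≤ Q ℚ.* Y ℚ.* Q′
entry-bound {B} {Y} {Q} {Q′} {w} 1≤B 1≤Q′ 11B≤QY w≤ = ℚ.*-cancelˡ-≤-pos (ι (+ 44)) (shift≤
  (132 ⊛ w≤ ⊕ 3 ⊛ scale 0≤Q′ 11B≤QY ⊕ 33 ⊛ scale 0≤Q′ 1≤B ⊕ 33 ⊛ 1≤Q′ ⊕ 8 ⊛ scale 0≤Q′ (ℚ.≤-trans 0≤11B 11B≤QY))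
  (solve 5 (λ B Y Q Q′ w →
      c 132 :* (Y :* con (inv (ι (+ 4))) :* Q :* Q′ :+ con (inv (ι (+ 4)))) :+ c 3 :* (Q′ :* (Q :* Y))
        :+ c 33 :* (Q′ :* B) :+ c 33 :* Q′ :+ c 8 :* (Q′ :* (Q :* Y))
      :- (c 132 :* w :+ c 3 :* (Q′ :* (c 11 :* B)) :+ c 33 :* (Q′ :* c 1) :+ c 33 :* c 1 :+ c 8 :* (Q′ :* c 0))
    := c 44 :* (Q :* Y :* Q′) :- c 44 :* (c 3 :* w)) refl B Y Q Q′ w))
  where
  0≤Q′ : 0ℚ ℚ.≤ Q′
  0≤Q′ = ℚ.≤-trans (ℚ.<⇒≤ 0<1) 1≤Q′
  0≤11B : 0ℚ ℚ.≤ ι (+ 11) ℚ.* B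
  0≤11B = 11 ⊛ ℚ.≤-trans (ℚ.<⇒≤ 0<1) 1≤B

0≤∧≢0⇒1≤ : ∀ {i} → + 0 ℤ.≤ i → {{NonZeroᶻ i}} → + 1 ℤ.≤ i
0≤∧≢0⇒1≤ {ℤ.+[1+ n ]} _ = ℤ.+≤+ (ℕ.s≤s ℕ.z≤n)

-- The conclusion is a negation, so a witness of the opposite strict inequality is given. It and the
-- hypotheses become rational inequalities valid eventually, which clash at any common index.
orbit-distance : (ξ : ℝ) (p q q′ : ℤ) → Coprime p q → + 1 ≤ᶻ q → q ≤ᶻ q′ →
  Eventually (λ n → ι q′ ℚ.* ℚ.∣ ι q ℚ.* seq ξ n ℚ.- ι p ∣ ℚ.≤ 1ℚ) →
  (y₁ y₂ : ℝ) {{_ : NonZero y₂}} (a b : ℤ) {{_ : NonZeroᶻ b}} {{q≢0 : NonZeroᶻ q}} →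
  + absℤ a ≤ᶻ b →
  y₁ ÷ y₂ ≃ fromℤ a ÷ fromℤ b →
  fromℤ (+ 12) * fromℤ b ÷ ∣ y₂ ∣ ≤ fromℤ q →
  (γ : SL₂ℤ) →
  fromℤ (+ maxEntry γ) ≤ ∣ y₂ ∣ ÷ fromℤ (+ 4) * fromℤ q * fromℤ q′ →
  1ℝ ÷ (fromℤ (+ 4) * fromℤ b * fromℤ q) ≤ ‖ γ • (ξ , 1ℝ) -ᵥ (y₁ , y₂) ‖
orbit-distance ξ p q q′ cop 1≤q q≤q′ error y₁ y₂ a b ∣a∣≤b slope far γ small (ε , 0<ε , near) =
  go (cauchy⇒bounded (seq y₂) (cauchy y₂)) (away y₂)
  where
  open SL₂ℤ γ
  B = ι b
  Q = ι q
  Q′ = ι q′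
  η = inv (ι (+ 4) ℚ.* B ℚ.* Q)
  d₁ d₂ : ℕ → ℚ
  d₁ n = ℚ.∣ ι γ₁₁ ℚ.* seq ξ n ℚ.+ ι γ₁₂ ℚ.* 1ℚ ℚ.- seq y₁ n ∣
  d₂ n = ℚ.∣ ι γ₂₁ ℚ.* seq ξ n ℚ.+ ι γ₂₂ ℚ.* 1ℚ ℚ.- seq y₂ n ∣
  1≤b : + 1 ℤ.≤ b
  1≤b = 0≤∧≢0⇒1≤ (ℤ.≤-trans (ℤ.+≤+ ℕ.z≤n) ∣a∣≤b)
  0<B : 0ℚ ℚ.< B
  0<B = ℚ.<-≤-trans 0<1 (1≤ι 1≤b)
  0<Q : 0ℚ ℚ.< Q
  0<Q = ℚ.<-≤-trans 0<1 (1≤ι 1≤q)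
  0<4bq : 0ℚ ℚ.< ι (+ 4) ℚ.* B ℚ.* Q
  0<4bq = *-pos (*-pos (ℚ.positive⁻¹ (ι (+ 4))) 0<B) 0<Q
  ∣γ₂₁∣≤ : ℚ.∣ ι γ₂₁ ∣ ℚ.≤ ι (+ maxEntry γ)
  ∣γ₂₁∣≤ = subst (ℚ._≤ ι (+ maxEntry γ)) (sym (ι-∣∣ γ₂₁)) (/1-mono-≤ (ℤ.+≤+
    (ℕ.≤-trans (ℕ.m≤n⊔m (absℤ γ₁₁ ℕ.⊔ absℤ γ₁₂) (absℤ γ₂₁)) (ℕ.m≤m⊔n _ (absℤ γ₂₂)))))
  component : ∀ g h y x → ℚ.∣ ι g ℚ.* x ℚ.+ ι h ℚ.* 1ℚ ℚ.- y ∣ ℚ.≤ η → ℚ.∣ ι g ℚ.* x ℚ.+ ι h ℚ.- y ∣ ℚ.≤ η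
  component g h y x = subst (λ r → ℚ.∣ ι g ℚ.* x ℚ.+ r ℚ.- y ∣ ℚ.≤ η) (ℚ.*-identityʳ (ι h))
  go : Bounded (seq y₂) → AwayFrom0 (seq y₂) → _
  go (C , 0<C , y₂≤C) (_ , 0<c , c≤y₂) =
    -- `C` bounds `y₂` from some index on. The tolerances are `δ = 1 / (8 * Q * B * C)` for the
    -- slope, `δ′ = 1 / C` for the size of `q`, and 1/4 for the norm of `γ`.
    let δ , 0<δ , δ≡ = share (*-pos (*-pos (ℚ.positive⁻¹ (ι (+ 8))) 0<Q) (*-pos 0<B 0<C)) 0<1
        δ′ , 0<δ′ , δ′≡ = share 0<C 0<1
        N , at = near ∧ₑ error ∧ₑ y₂≤C ∧ₑ c≤y₂ ∧ₑ slope δ 0<δ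
          ∧ₑ ≤⇒eventually-≤ (fromℤ (+ 12) * fromℤ b ÷ ∣ y₂ ∣) (fromℤ q) 0<δ′ far
          ∧ₑ ≤⇒eventually-≤ (fromℤ (+ maxEntry γ)) (∣ y₂ ∣ ÷ fromℤ (+ 4) * fromℤ q * fromℤ q′)
               (inv-pos (ℚ.positive⁻¹ (ι (+ 4)))) small
        nearₙ , errorₙ , y₂≤C , c≤y₂ , slopeₙ , farₙ , smallₙ = at N ℕ.≤-refl
        y₂≢0 = ∣p∣≢0⇒p≢0 0<c c≤y₂
        ‖d‖≤η = subst (d₁ N ℚ.⊔ d₂ N ℚ.≤_) (ℚ.*-identityˡ η) (p+ε≤q⇒p≤q (d₁ N ℚ.⊔ d₂ N) (1ℚ ℚ.* η) 0<ε nearₙ)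
        11b≤Z = clear-denominator {Q = Q} (1≤ι 1≤b) (0<∣p∣ y₂≢0) (ℚ.<⇒≤ 0<δ′) y₂≤C δ′≡ farₙ
    in nearby-orbit-point-impossible γ a b p q q′ (seq ξ N) (seq y₁ N) (seq y₂ N) η
      cop ∣a∣≤b 1≤b 1≤q q≤q′ (inv-inverseʳ (pos⇒≢0 0<4bq)) (ℚ.<⇒≤ (inv-pos 0<4bq))
      (component γ₁₁ γ₁₂ (seq y₁ N) (seq ξ N) (ℚ.≤-trans (ℚ.p≤p⊔q (d₁ N) (d₂ N)) ‖d‖≤η))
      (component γ₂₁ γ₂₂ (seq y₂ N) (seq ξ N) (ℚ.≤-trans (ℚ.p≤q⊔p (d₁ N) (d₂ N)) ‖d‖≤η))
      (slope-error {A = ι a} 0<B y₂≢0 (ℚ.<⇒≤ 0<Q) y₂≤C δ≡ (ℚ.<⇒≤ slopeₙ))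
      11b≤Z
      (entry-bound {Y = ℚ.∣ seq y₂ N ∣} {Q = Q} (1≤ι 1≤b) (ℚ.≤-trans (1≤ι 1≤q) (/1-mono-≤ q≤q′)) 11b≤Z (ℚ.≤-trans ∣γ₂₁∣≤ smallₙ))
      errorₙ

theorem4 :
    (ξ : ℝ) (irr : Irrational ξ) →
    let q : ℕ → ℤ
        q = denominator ξ irr in
    (y₁ y₂ : ℝ) {{_ : NonZero y₂}} →
    (a b : ℤ) {{_ : NonZeroᶻ b}} →
    Coprime a b →
    + absℤ a ≤ᶻ b →
    y₁ ÷ y₂ ≃ fromℤ a ÷ fromℤ b →
    (k : ℕ) → 1 ≤ᴺ k →
    fromℤ (+ 12) * fromℤ b ÷ ∣ y₂ ∣ ≤ fromℤ (q k) →
    (γ : SL₂ℤ) →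
    fromℤ (+ maxEntry γ) ≤ ∣ y₂ ∣ ÷ fromℤ (+ 4) * fromℤ (q k) * fromℤ (q (suc k)) →
    let instance qₖ≢0 : NonZeroᶻ (q k)
                 qₖ≢0 = denominator-nonZero ξ irr k in
    1ℝ ÷ (fromℤ (+ 4) * fromℤ b * fromℤ (q k)) ≤ ‖ γ • (ξ , 1ℝ) -ᵥ (y₁ , y₂) ‖
theorem4 ξ irr y₁ y₂ a b _ ∣a∣≤b slope k _ far γ small =
  orbit-distance ξ (numerator ξ irr k) (q k) (q (suc k)) (coprime-convergent (partialQuotient (ξ , irr)) k)
    (1≤denominator ξ irr k)
    (denominators-mono (partialQuotient (ξ , irr)) (1≤partialQuotient (ξ , irr)) (0≤denominator ξ irr) k)
    (convergent-error ξ irr k) y₁ y₂ a b {{q≢0 = denominator-nonZero ξ irr k}} ∣a∣≤b slope far γ small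
  where q = denominator ξ irr
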